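{- Let $d\geq 2$ be a natural number. Let $\Gamma=(U,V,E)$ be a highly computable bipartite graph such that: (1) both $U$ and $V$ are identified with (are disjoint copies of) $\mathbb{N}\setminus\{0\}$; (2) $E$ does not contain edges of the form $(u,v_u)$, where $v_u\in V$ is the copy of $u\in U$ (the same natural number); (3) $\Gamma$ is fully reflected; (4) $\Gamma$ satisfies the computable expanding Hall's harem condition with respect to $d$, $c.e.H.h.c.(d)$. Then there exists a computable perfect $(1,d-1)$-matching $M$ of $\Gamma$ which realizes a computable $(d-1)$ to $1$ function $f:\mathbb{N}\setminus\{0\}\to\mathbb{N}\setminus\{0\}$ with controlled sizes of its cycles.
   Context: A bipartite graph $\Gamma=(U,V,E)$ has vertex set the disjoint union of $U$ and $V$, and $E\subseteq U\times V$. For a vertex $x$, $N(x)$ is the set of vertices adjacent to $x$ (so $N(u)\subseteq V$ for $u\in U$ and $N(v)\subseteq U$ for $v\in V$), and $N(X)=\bigcup_{x\in X}N(x)$. With $U$ and $V$ copies of $\mathbb{N}\setminus\{0\}$: $u_v\in U$ denotes the copy of $v\in V$ and $v_u\in V$ the copy of $u\in U$ (same natural number). $\Gamma$ is fully reflected if for every $(u,v)\in E$ also $(u_v,v_u)\in E$. $\Gamma$ is highly computable if $E$ is a computable set of pairs, all $N(x)$ are finite, and the functions $u\mapsto|N(u)|$ ($u\in U$) and $v\mapsto|N(v)|$ ($v\in V$) are computable. $\Gamma$ satisfies $c.e.H.h.c.(k)$ if there is a total computable function $h:\mathbb{N}\to\mathbb{N}$ such that: $h(0)=0$; for all finite $X\subset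 U$ and all $n$, $h(n)\leq|X|$ implies $n\leq|N(X)|-k|X|$; for all finite $Y\subset V$ and all $n$, $h(n)\leq|Y|$ implies $n\leq|N(Y)|-\frac1k|Y|$. A perfect $(1,k)$-matching of $\Gamma$ is a set $M\subseteq E$ such that each $u\in U$ has exactly $k$ vertices $v\in V$ with $(u,v)\in M$, and each $v\in V$ has exactly one $u\in U$ with $(u,v)\in M$. It is computable if $M$ is a computable set of pairs. The function $f$ realized by $M$ is given by $f(v)=u$ iff $(u,v)\in M$ (elements of $U$ and $V$ viewed as natural numbers); it is $k$ to $1$, i.e. every value has exactly $k$ preimages. A $(d-1)$ to $1$ function $f$ has controlled sizes of its cycles if: (i) $f^2(1)=1$; (ii) for every $n\geq2$ that is a periodic point of $f$, the cycle of $n$ has length at most $n$, i.e. the least $i\ge 1$ with $f^i(n)=n$ satisfies $i\leq n$; (iii) if $n\geq2$ and $f^i(n)\neq n$ for all $1\le i\leq n$, then there exist $k\leq 2n$ and $1\le l\leq n$ such that $f^{k+l}(n)=f^k(n)$. -}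

module Defs where

open import Data.Bool.Base using (if_then_else_)
open import Data.Fin.Base using (Fin)
open import Data.Integer.Base as ℤ using (+_)
open import Data.Irrelevant using ([_])
open import Data.List.Base using (List; length)
open import Data.List.Membership.Propositional using (_∈_)
open import Data.List.Relation.Unary.Unique.Propositional using (Unique)
open import Data.Nat.Base using (ℕ; zero; suc; _+_; _*_; _≤_; _<_; NonZero)
open import Data.Product using (Σ-syntax; ∃-syntax; ∃!; _×_)
open import Data.Rational.Unnormalised.Base as ℚᵘ using (_/_)
open import Data.Refinement.Base using (Refinement-syntax; value; _,_)
open import Data.Vec.Base using (Vec; []; _∷_; head; lookup; tabulate)
open import Function.Base using (flip; _∘_)
open import Function.Bundles using (_⇔_)
import Function.Endo.Propositional as Endo
open import Level using (0ℓ)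
open import Relation.Binary.Core using (REL; Rel; _⇒_)
open import Relation.Binary.Definitions using (Decidable; Irreflexive; Symmetric)
open import Relation.Binary.PropositionalEquality using (_≡_; _≢_; _≗_)
open import Relation.Nullary.Decidable.Core using (does)
open import Relation.Unary using (Pred)

private
  variable
    A B : Set
    m n : ℕ

------------------------------------------------------------------------
-- Computability

primRec : (Vec ℕ n → ℕ) → (Vec ℕ (suc (suc n)) → ℕ) → Vec ℕ (suc n) → ℕ
primRec f g (zero  ∷ xs) = f xs
primRec f g (suc y ∷ xs) = g (y ∷ primRec f g (y ∷ xs) ∷ xs)

IsLeastZero : (ℕ → ℕ) → ℕ → Set
IsLeastZero f y = f y ≡ 0 × (∀ z → z < y → f z ≢ 0)

-- The total computable functions: the smallest class containing the
-- initial functions and closed under composition, primitive recursion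
-- and regular minimisation (minimisation of a function that has a zero
-- for all values of the parameters).  As there is no function
-- extensionality, closure under pointwise equality is required too.

data Recursive : (Vec ℕ n → ℕ) → Set where
  zeroᴿ : Recursive {0} (λ _ → 0)
  sucᴿ  : Recursive {1} (λ xs → suc (head xs))
  projᴿ : (i : Fin n) → Recursive (λ xs → lookup xs i)
  compᴿ : {f : Vec ℕ m → ℕ} {g : Fin m → Vec ℕ n → ℕ} →
          Recursive f → (∀ i → Recursive (g i)) →
          Recursive (λ xs → f (tabulate λ i → g i xs))
  primᴿ : {f : Vec ℕ n → ℕ} {g : Vec ℕ (suc (suc n)) → ℕ} →
          Recursive f → Recursive g → Recursive (primRec f g)
  minᴿ  : {f : Vec ℕ (suc n) → ℕ} {μf : Vec ℕ n → ℕ} →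
          Recursive f →
          (∀ xs → IsLeastZero (λ y → f (y ∷ xs)) (μf xs)) →
          Recursive μf
  extᴿ  : {f g : Vec ℕ n → ℕ} → f ≗ g → Recursive f → Recursive g

ℕ⁺ : Set
ℕ⁺ = [ n ∈ ℕ ∣ NonZero n ]

1⁺ : ℕ⁺
1⁺ = 1 , [ _ ]

Computable : (ℕ → ℕ) → Set
Computable f = Recursive {1} (λ xs → f (head xs))

-- A function on positive numbers is computable when it is the
-- restriction of a total computable function on natural numbers.

Computable⁺ : (ℕ⁺ → ℕ) → Set
Computable⁺ f =
  Σ[ g ∈ (Vec ℕ 1 → ℕ) ] Recursive g × (∀ x → g (value x ∷ []) ≡ f x)

Computable⁺₂ : (ℕ⁺ → ℕ⁺ → ℕ) → Set
Computable⁺₂ f =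
  Σ[ g ∈ (Vec ℕ 2 → ℕ) ]
    Recursive g × (∀ x y → g (value x ∷ value y ∷ []) ≡ f x y)

ComputableSet : Rel ℕ⁺ 0ℓ → Set
ComputableSet R =
  Σ[ R? ∈ Decidable R ] Computable⁺₂ (λ x y → if does (R? x y) then 1 else 0)

------------------------------------------------------------------------
-- Bipartite graphs

-- A bipartite graph with sides U and V is its edge set E : REL U V 0ℓ.
-- The sides are distinguished by argument position, hence disjoint even
-- when U and V are the same type; neighbourhoods of vertices in V are
-- taken in flip E.

record _HasSize_ (P : Pred A 0ℓ) (n : ℕ) : Set where
  field
    elements : List A
    unique   : Unique elements
    complete : ∀ x → P x ⇔ x ∈ elements
    size     : length elements ≡ n

N : REL A B 0ℓ → A → Pred B 0ℓ
N E x y = E x y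

N[_] : REL A B 0ℓ → List A → Pred B 0ℓ
N[ E ] X y = ∃[ x ] (x ∈ X × N E x y)

record HighlyComputable (E : Rel ℕ⁺ 0ℓ) : Set where
  field
    computableEdges : ComputableSet E
    degᵁ degⱽ       : ℕ⁺ → ℕ
    degᵁ-size       : ∀ u → N E u HasSize degᵁ u
    degⱽ-size       : ∀ v → N (flip E) v HasSize degⱽ v
    degᵁ-computable : Computable⁺ degᵁ
    degⱽ-computable : Computable⁺ degⱽ

-- Finite sets of vertices are duplicate-free lists.  The variables p
-- and q stand for |N(X)| and |N(Y)|; an infinite neighbourhood would
-- satisfy the inequalities trivially.

record CEHallHarem (k : ℕ) .{{_ : NonZero k}} {U V : Set} (E : REL U V 0ℓ) : Set where
  field
    h            : ℕ → ℕ
    h-computable : Computable h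
    h-zero       : h 0 ≡ 0
    expandᵁ      : ∀ (X : List U) → Unique X → ∀ p → N[ E ] X HasSize p →
                   ∀ n → h n ≤ length X →
                   + n ℤ.≤ + p ℤ.- + (k * length X)
    expandⱽ      : ∀ (Y : List V) → Unique Y → ∀ q → N[ flip E ] Y HasSize q →
                   ∀ n → h n ≤ length Y →
                   (+ n / 1) ℚᵘ.≤ (+ q / 1) ℚᵘ.- (+ 1 / k) ℚᵘ.* (+ length Y / 1)

NoEdgeToCopy : Rel ℕ⁺ 0ℓ → Set
NoEdgeToCopy E = Irreflexive _≡_ E

-- For an edge (u , v), the copy of v in U and the copy of u in V form
-- the pair (v , u).

FullyReflected : Rel ℕ⁺ 0ℓ → Set
FullyReflected E = Symmetric E

record PerfectMatching (k : ℕ) {U V : Set} (E M : REL U V 0ℓ) : Set where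
  field
    edges   : M ⇒ E
    uniqueᵁ : ∀ v → ∃! _≡_ (λ u → M u v)
    k-manyⱽ : ∀ u → (λ v → M u v) HasSize k

------------------------------------------------------------------------
-- Functions realized by matchings

Realizes : {U V : Set} → REL U V 0ℓ → (V → U) → Set
Realizes M f = ∀ u v → f v ≡ u ⇔ M u v

_to-1 : ℕ → (A → B) → Set
(k to-1) f = ∀ y → (λ x → f x ≡ y) HasSize k

open Endo ℕ⁺ using (_^_)

IsCycleLength : (ℕ⁺ → ℕ⁺) → ℕ⁺ → ℕ → Set
IsCycleLength f x i =
  1 ≤ i × (f ^ i) x ≡ x × (∀ j → 1 ≤ j → j < i → (f ^ j) x ≢ x)

record ControlledCycles (f : ℕ⁺ → ℕ⁺) : Set where
  field
    one         : (f ^ 2) 1⁺ ≡ 1⁺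
    periodic    : ∀ x → 2 ≤ value x → ∀ i → IsCycleLength f x i → i ≤ value x
    nonperiodic : ∀ x → 2 ≤ value x →
                  (∀ i → 1 ≤ i → i ≤ value x → (f ^ i) x ≢ x) →
                  ∃[ k ] ∃[ l ] (k ≤ 2 * value x × 1 ≤ l × l ≤ value x ×
                                 (f ^ (k + l)) x ≡ (f ^ k) x)

{-# OPTIONS --safe #-}
module Submission where

-- The graph E is symmetric, so only expansion of finite sets X ⊆ U is needed.
-- First choose, greedily and vertex by vertex, d children for every u so that
-- no v is chosen twice: v is acceptable if the remaining vertices still satisfy
-- Hall's condition.  By the expanding condition it suffices to test this for
-- sets X inside a computable ball, because large X satisfy it automatically and
-- a small X misses one of many layers around the vertices used so far, so it
-- splits into a part inside the ball and a part that was not affected.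
--
-- This gives a partial d to 1 function P.  Every u then drops one child, chosen
-- such that the forward orbit of n under P meets a dropped or parentless vertex
-- (a root) or closes up within 2n steps.  Finally, each root r starts a ray
-- r, r₁, r₂, … of children, and f exchanges r and r₁, r₂ and r₃, and so on, and
-- agrees with P elsewhere.  This keeps f (d - 1) to 1 and ends the orbit of n in
-- a 2-cycle or in a short cycle of P.
open import Defs
open import Algebra.Properties.CommutativeSemigroup using (interchange)
open import Data.Bool.Base using (Bool; true; false; T; _∧_; _∨_; not; if_then_else_)
open import Data.Bool.Properties using (T-∧; T-∨; ∨-identityʳ; not-involutive)
open import Data.Empty using (⊥; ⊥-elim; ⊥-elim-irr)
open import Data.Fin.Base using (Fin; zero; suc; toℕ; fromℕ<)
open import Data.Fin.Properties using (pigeonhole; toℕ<n; fromℕ<-injective)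
import Data.Integer.Base as ℤ
import Data.Integer.Properties as ℤ
open import Data.Irrelevant using ([_])
open import Data.List.Base using (List; []; _∷_; _++_; length; filter; upTo) renaming (map to mapᴸ)
open import Data.List.Membership.Propositional using (_∈_)
open import Data.List.Membership.Propositional.Properties
  using (∈-∃++; ∈-++⁺ˡ; ∈-++⁺ʳ; ∈-++⁻; ∈-map⁺; ∈-map⁻; ∈-upTo⁺; ∈-upTo⁻; ∈-filter⁺; ∈-filter⁻)
open import Data.List.Properties using (length-++; length-map; length-upTo)
open import Data.List.Relation.Unary.All as All using ([]; _∷_)
open import Data.List.Relation.Unary.AllPairs using ([]; _∷_)
open import Data.List.Relation.Unary.Any using (here; there)
open import Data.List.Relation.Unary.Unique.Propositional using (Unique)
open import Data.List.Relation.Unary.Unique.Propositional.Properties using (map⁺; filter⁺; upTo⁺)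
open import Data.Nat.Base
open import Data.Nat.Properties
open import Data.Product.Base using (Σ-syntax; ∃-syntax; _×_; _,_; proj₁; proj₂)
open import Data.Refinement.Base using (value; _,_)
open import Data.Refinement.Properties using (value-injective)
open import Data.Sum.Base using (_⊎_; inj₁; inj₂)
open import Data.Unit.Base using (tt)
open import Data.Vec.Base using (Vec; []; _∷_; head; tail; lookup)
open import Data.Vec.Properties using (tabulate∘lookup)
open import Function.Base using (_∘_)
open import Function.Bundles using (_⇔_; mk⇔; module Equivalence)
import Function.Endo.Propositional as Endo
open import Level using (0ℓ)
open import Relation.Binary.Core using (Rel)
open import Relation.Binary.Definitions using (tri<; tri≈; tri>)
open import Relation.Binary.PropositionalEquality
open import Relation.Nullary using (¬_; Dec; does; yes; no; contradiction)
open import Relation.Nullary.Decidable using (map′; ¬?)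
open import Relation.Unary using (Pred)

open Equivalence using (to; from)

-- A perfect `(1, d - 1)`-matching alone says nothing about the cycles. The extra child supplied by
-- `d` is what controls them: dropping one child per vertex does not harm the count, and each
-- dropped child cuts orbits. So that `n` meets a cut soon, `u` drops the child used by the least
-- `m` reaching `u` within `m + 1` steps. The `n + 1` vertices that follow `n` on its orbit are
-- reached by `n` itself, so their least `m` lie in 1, ..., n. By the pigeonhole principle two of
-- them share the same `m`, and then the orbit either contains a dropped child or closes up. A root
-- has lost its image, and giving it one must not disturb the counts. On the ray, `r₁` gains the
-- preimage `r` and gives up `r₂`, which is sent to `r₃`, which gives up `r₄`, and so on. The ray
-- must never stop, hence every vertex needs a child besides the dropped one, and `d ≥ 2` provides
-- it. For `f` to be computable, parity on a ray must be decidable. It is, because an orbit without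
-- a root in its first `2n` steps repeats inside them and never meets a root.

private
  variable
    n : ℕ

-- Bounded quantification, summation and search

⟦_⟧ : Bool → ℕ
⟦ b ⟧ = if b then 1 else 0

∑ : ℕ → (ℕ → ℕ) → ℕ
∑ zero    f = 0
∑ (suc n) f = ∑ n f + f n

count : ℕ → (ℕ → Bool) → ℕ
count n p = ∑ n (λ i → ⟦ p i ⟧)

anyBelow allBelow : ℕ → (ℕ → Bool) → Bool
anyBelow zero    p = false
anyBelow (suc n) p = anyBelow n p ∨ p n
allBelow zero    p = true
allBelow (suc n) p = allBelow n p ∧ p n

-- The value is the bound itself if nothing below it qualifies. The test at `least n p` either
-- confirms the witness already found or, when that value is `n`, examines `n` for the first time;
-- this makes the search primitive recursive.
least : ℕ → (ℕ → Bool) → ℕ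
least zero    p = 0
least (suc n) p = if p (least n p) then least n p else suc n

∧-intro : ∀ {a b} → T a → T b → T (a ∧ b)
∧-intro x y = Equivalence.from T-∧ (x , y)

∧-elim : ∀ {a b} → T (a ∧ b) → T a × T b
∧-elim = Equivalence.to T-∧

∨-elim : ∀ {a b} → T (a ∨ b) → T a ⊎ T b
∨-elim = Equivalence.to T-∨

∨-introˡ : ∀ {a b} → T a → T (a ∨ b)
∨-introˡ x = Equivalence.from T-∨ (inj₁ x)

∨-introʳ : ∀ {a b} → T b → T (a ∨ b)
∨-introʳ {a} x = Equivalence.from (T-∨ {a}) (inj₂ x)

not-intro : ∀ {a} → ¬ T a → T (not a)
not-intro {true}  h = h tt
not-intro {false} h = tt

not-elim : ∀ {a} → T (not a) → ¬ T a
not-elim {true} ()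
not-elim {false} _ ()

T-split : ∀ a → T a ⊎ ¬ T a
T-split true  = inj₁ tt
T-split false = inj₂ (λ ())

T-ext : ∀ {a b} → (T a → T b) → (T b → T a) → a ≡ b
T-ext {false} {false} f g = refl
T-ext {false} {true}  f g = ⊥-elim (g tt)
T-ext {true}  {false} f g = ⊥-elim (f tt)
T-ext {true}  {true}  f g = refl

⟦T⟧ : ∀ {a} → T a → ⟦ a ⟧ ≡ 1
⟦T⟧ {true} _ = refl

⟦¬T⟧ : ∀ {a} → ¬ T a → ⟦ a ⟧ ≡ 0
⟦¬T⟧ {true}  h = ⊥-elim (h tt)
⟦¬T⟧ {false} h = refl

⟦⟧-mono : ∀ {a b} → (T a → T b) → ⟦ a ⟧ ≤ ⟦ b ⟧
⟦⟧-mono {false}         f = z≤n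
⟦⟧-mono {true}  {true}  f = ≤-refl
⟦⟧-mono {true}  {false} f = ⊥-elim (f tt)

≤-suc-split : ∀ {i n} → i < suc n → i < n ⊎ i ≡ n
≤-suc-split i<1+n = m≤n⇒m<n∨m≡n (≤-pred i<1+n)

∑-cong : ∀ n {f g} → (∀ i → i < n → f i ≡ g i) → ∑ n f ≡ ∑ n g
∑-cong zero    e = refl
∑-cong (suc n) e = cong₂ _+_ (∑-cong n (λ i i<n → e i (m≤n⇒m≤1+n i<n))) (e n ≤-refl)

∑-mono : ∀ n {f g} → (∀ i → i < n → f i ≤ g i) → ∑ n f ≤ ∑ n g
∑-mono zero    e = z≤n
∑-mono (suc n) e = +-mono-≤ (∑-mono n (λ i i<n → e i (m≤n⇒m≤1+n i<n))) (e n ≤-refl)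

∑-+ : ∀ n f g → ∑ n (λ i → f i + g i) ≡ ∑ n f + ∑ n g
∑-+ zero    f g = refl
∑-+ (suc n) f g rewrite ∑-+ n f g = interchange +-commutativeSemigroup (∑ n f) (∑ n g) (f n) (g n)

∑-*ˡ : ∀ n c f → ∑ n (λ i → c * f i) ≡ c * ∑ n f
∑-*ˡ zero    c f = sym (*-zeroʳ c)
∑-*ˡ (suc n) c f rewrite ∑-*ˡ n c f = sym (*-distribˡ-+ c (∑ n f) (f n))

∑-≤-bound : ∀ {n m} f → n ≤ m → ∑ n f ≤ ∑ m f
∑-≤-bound {n} {zero}  f z≤n = z≤n
∑-≤-bound {n} {suc m} f n≤1+m with m≤n⇒m<n∨m≡n n≤1+m
... | inj₁ n<1+m = ≤-trans (∑-≤-bound f (≤-pred n<1+m)) (m≤m+n _ _)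
... | inj₂ refl  = ≤-refl

∑-term : ∀ {n i} f → i < n → f i ≤ ∑ n f
∑-term {n} {i} f i<n = ≤-trans (m≤n+m (f i) (∑ i f)) (∑-≤-bound f i<n)

∑-support : ∀ {n m} f → n ≤ m → (∀ i → n ≤ i → f i ≡ 0) → ∑ m f ≡ ∑ n f
∑-support {n} {zero}  f z≤n z = refl
∑-support {n} {suc m} f n≤1+m z with m≤n⇒m<n∨m≡n n≤1+m
... | inj₁ n<1+m rewrite z m (≤-pred n<1+m) | +-identityʳ (∑ m f) = ∑-support f (≤-pred n<1+m) z
... | inj₂ refl  = refl

∑-≡0 : ∀ n {f} → (∀ i → i < n → f i ≡ 0) → ∑ n f ≡ 0
∑-≡0 zero    z = refl
∑-≡0 (suc n) z rewrite ∑-≡0 n (λ i i<n → z i (m≤n⇒m≤1+n i<n)) = z n ≤-refl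

count-singleton : ∀ n v → count n (_≡ᵇ v) ≤ 1
count-singleton n v with <-≤-connex v n
... | inj₂ n≤v = ≤-trans (≤-reflexive (∑-≡0 n (λ i i<n → ⟦¬T⟧ (λ t → <⇒≢ (<-≤-trans i<n n≤v) (≡ᵇ⇒≡ i v t))))) z≤n
... | inj₁ v<n = ≤-reflexive (trans
  (∑-support _ v<n (λ i v<i → ⟦¬T⟧ (λ t → <⇒≢ v<i (sym (≡ᵇ⇒≡ i v t)))))
  (cong₂ _+_ (∑-≡0 v (λ i i<v → ⟦¬T⟧ (λ t → <⇒≢ i<v (≡ᵇ⇒≡ i v t)))) (⟦T⟧ (≡⇒≡ᵇ v v refl))))

any-intro : ∀ {n i} p → i < n → T (p i) → T (anyBelow n p)
any-intro {suc n} p i<1+n pi with ≤-suc-split i<1+n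
... | inj₁ i<n  = ∨-introˡ (any-intro p i<n pi)
... | inj₂ refl = ∨-introʳ {anyBelow n p} pi

any-elim : ∀ n p → T (anyBelow n p) → ∃[ i ] i < n × T (p i)
any-elim (suc n) p t with ∨-elim {anyBelow n p} t
... | inj₁ l = let i , i<n , pi = any-elim n p l in i , m≤n⇒m≤1+n i<n , pi
... | inj₂ r = n , ≤-refl , r

all-intro : ∀ n p → (∀ i → i < n → T (p i)) → T (allBelow n p)
all-intro zero    p f = tt
all-intro (suc n) p f = ∧-intro (all-intro n p (λ i i<n → f i (m≤n⇒m≤1+n i<n))) (f n ≤-refl)

all-elim : ∀ {n} p → T (allBelow n p) → ∀ {i} → i < n → T (p i)
all-elim {suc n} p t i<1+n with ∧-elim {allBelow n p} t | ≤-suc-split i<1+n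
... | l , _ | inj₁ i<n  = all-elim p l i<n
... | _ , r | inj₂ refl = r

all-counterexample : ∀ n p → ¬ T (allBelow n p) → ∃[ i ] i < n × ¬ T (p i)
all-counterexample zero    p h = ⊥-elim (h tt)
all-counterexample (suc n) p h with T-split (p n)
... | inj₂ ¬pn = n , ≤-refl , ¬pn
... | inj₁ pn  =
  let i , i<n , ¬pi = all-counterexample n p (λ t → h (∧-intro t pn)) in i , m≤n⇒m≤1+n i<n , ¬pi

least-≤ : ∀ n p → least n p ≤ n
least-≤ zero    p = z≤n
least-≤ (suc n) p with p (least n p)
... | true  = m≤n⇒m≤1+n (least-≤ n p)
... | false = ≤-refl

least-found : ∀ n p → least n p < n → T (p (least n p))
least-found (suc n) p l< with p (least n p) in eq
... | true  = subst T (sym eq) tt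
... | false = ⊥-elim (<-irrefl refl l<)

least-minimal : ∀ n p {i} → i < least n p → ¬ T (p i)
least-minimal (suc n) p {i} i<l pi with p (least n p) in eq
... | true = least-minimal n p i<l pi
... | false with <-cmp i (least n p)
...   | tri< i<l′ _ _ = least-minimal n p i<l′ pi
...   | tri≈ _ refl _ = subst T eq pi
...   | tri> _ _ l<i with m≤n⇒m<n∨m≡n (least-≤ n p)
...     | inj₂ l≡n = <⇒≱ l<i (subst (i ≤_) (sym l≡n) (≤-pred i<l))
...     | inj₁ l<n = subst T eq (least-found n p l<n)

least-≤-witness : ∀ n p {i} → T (p i) → least n p ≤ i
least-≤-witness n p {i} pi with <-≤-connex i (least n p)
... | inj₁ i<l = ⊥-elim (least-minimal n p i<l pi)
... | inj₂ l≤i = l≤i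

least-witness : ∀ {n i} p → i < n → T (p i) → T (p (least n p))
least-witness {n} p i<n pi = least-found n p (≤-<-trans (least-≤-witness n p pi) i<n)

-- Finite sets coded by binary expansions

odd : ℕ → Bool
odd zero    = false
odd (suc n) = not (odd n)

half : ℕ → ℕ
half zero    = 0
half (suc n) = half n + ⟦ odd n ⟧

halves : ℕ → ℕ → ℕ
halves zero    X = X
halves (suc i) X = half (halves i X)

bit : ℕ → ℕ → Bool
bit i X = odd (halves i X)

encode : ℕ → (ℕ → Bool) → ℕ
encode zero    p = 0
encode (suc n) p = ⟦ p 0 ⟧ + (encode n (p ∘ suc) + encode n (p ∘ suc))

halves-half : ∀ i X → halves (suc i) X ≡ halves i (half X)
halves-half zero    X = refl
halves-half (suc i) X = cong half (halves-half i X)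

odd-+double : ∀ B c → odd (B + (c + c)) ≡ odd B
odd-+double B zero = cong odd (+-identityʳ B)
odd-+double B (suc c) rewrite +-suc c c | +-suc B (suc (c + c)) | +-suc B (c + c) =
  trans (not-involutive _) (odd-+double B c)

half-+double : ∀ B c → half (B + (c + c)) ≡ half B + c
half-+double B zero = trans (cong half (+-identityʳ B)) (sym (+-identityʳ (half B)))
half-+double B (suc c) rewrite +-suc c c | +-suc B (suc (c + c)) | +-suc B (c + c) | half-+double B c
  | odd-+double B c with odd B
... | true  = trans (+-assoc (half B + c) 1 0) (trans (+-assoc (half B) c 1) (cong (half B +_) (+-comm c 1)))
... | false rewrite +-identityʳ (half B + c) = trans (+-assoc (half B) c 1) (cong (half B +_) (+-comm c 1))

bit-encode : ∀ {n i} p → i < n → bit i (encode n p) ≡ p i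
bit-encode {suc n} {zero}  p _ = trans (odd-+double ⟦ p 0 ⟧ (encode n (p ∘ suc))) (odd-⟦⟧ (p 0))
  where
  odd-⟦⟧ : ∀ b → odd ⟦ b ⟧ ≡ b
  odd-⟦⟧ true  = refl
  odd-⟦⟧ false = refl
bit-encode {suc n} {suc i} p (s≤s i<n) = begin
  odd (halves (suc i) (encode (suc n) p))   ≡⟨ cong odd (halves-half i (encode (suc n) p)) ⟩
  odd (halves i (half (encode (suc n) p)))  ≡⟨ cong (odd ∘ halves i) (half-+double ⟦ p 0 ⟧ (encode n (p ∘ suc))) ⟩
  odd (halves i (half ⟦ p 0 ⟧ + encode n (p ∘ suc))) ≡⟨ cong (λ z → odd (halves i (z + encode n (p ∘ suc)))) (half-⟦⟧ (p 0)) ⟩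
  bit i (encode n (p ∘ suc))                ≡⟨ bit-encode (p ∘ suc) i<n ⟩
  p (suc i)                                 ∎
  where
  open ≡-Reasoning
  half-⟦⟧ : ∀ b → half ⟦ b ⟧ ≡ 0
  half-⟦⟧ true  = refl
  half-⟦⟧ false = refl

encode-< : ∀ n p → encode n p < 2 ^ n
encode-< zero    p = s≤s z≤n
encode-< (suc n) p rewrite +-identityʳ (2 ^ n) with p 0
... | false = +-mono-<-≤ (encode-< n (p ∘ suc)) (<⇒≤ (encode-< n (p ∘ suc)))
... | true  = subst (_≤ 2 ^ n + 2 ^ n) (cong suc (+-suc code code)) (+-mono-≤ (encode-< n (p ∘ suc)) (encode-< n (p ∘ suc)))
  where
  code = encode n (p ∘ suc)

-- No carry arises, since bit `v` of `B` is 0. A growing finite set can thus be kept as one number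
-- and extended by addition.
bit-insert : ∀ v w B → ¬ T (bit v B) → bit w (B + 2 ^ v) ≡ bit w B ∨ (w ≡ᵇ v)
bit-insert zero zero B ∉ rewrite +-comm B 1 with odd B | ∉
... | true  | ∉′ = ⊥-elim (∉′ tt)
... | false | _  = refl
bit-insert zero (suc w) B ∉ rewrite +-comm B 1 | halves-half w (suc B) | halves-half w B with odd B | ∉
... | true  | ∉′ = ⊥-elim (∉′ tt)
... | false | _ rewrite +-identityʳ (half B) = sym (∨-identityʳ _)
bit-insert (suc v) zero B ∉ rewrite +-identityʳ (2 ^ v) = trans (odd-+double B (2 ^ v)) (sym (∨-identityʳ _))
bit-insert (suc v) (suc w) B ∉
  rewrite +-identityʳ (2 ^ v) | halves-half w (B + (2 ^ v + 2 ^ v)) | half-+double B (2 ^ v)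
        | halves-half w B = bit-insert v w (half B) (λ t → ∉ (subst (T ∘ odd) (sym (halves-half v B)) t))

bit-0 : ∀ w → ¬ T (bit w 0)
bit-0 w t = subst T (cong odd (halves-0 w)) t
  where
  halves-0 : ∀ w → halves w 0 ≡ 0
  halves-0 zero    = refl
  halves-0 (suc w) = cong half (halves-0 w)

-- Closure properties of recursive functions

Decᴿ : (Vec ℕ n → Bool) → Set
Decᴿ p = Recursive (λ xs → ⟦ p xs ⟧)

-- Lets a function defined by its own recursion equations, rather than by `primRec`, count as
-- recursive; `extᴿ` bridges the two.
natrecᴿ : {F : Vec ℕ (suc n) → ℕ} {f : Vec ℕ n → ℕ} {g : Vec ℕ (suc (suc n)) → ℕ} →
  Recursive f → Recursive g → (∀ xs → F (0 ∷ xs) ≡ f xs) →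
  (∀ y xs → F (suc y ∷ xs) ≡ g (y ∷ F (y ∷ xs) ∷ xs)) → Recursive F
natrecᴿ {F = F} {f} {g} fᴿ gᴿ e₀ eₛ = extᴿ eq (primᴿ fᴿ gᴿ)
  where
  eq : primRec f g ≗ F
  eq (zero  ∷ xs) = sym (e₀ xs)
  eq (suc y ∷ xs) = trans (cong (λ z → g (y ∷ z ∷ xs)) (eq (y ∷ xs))) (sym (eₛ y xs))

comp₁ : {f : Vec ℕ 1 → ℕ} {g : Vec ℕ n → ℕ} → Recursive f → Recursive g → Recursive (λ xs → f (g xs ∷ []))
comp₁ fᴿ gᴿ = compᴿ fᴿ (λ _ → gᴿ)

comp₂ : {f : Vec ℕ 2 → ℕ} {g h : Vec ℕ n → ℕ} → Recursive f → Recursive g → Recursive h →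
        Recursive (λ xs → f (g xs ∷ h xs ∷ []))
comp₂ {g = g} {h} fᴿ gᴿ hᴿ = compᴿ {g = λ { zero → g ; (suc _) → h }} fᴿ (λ { zero → gᴿ ; (suc _) → hᴿ })

-- Bounded operators recurse on their bound, so the bound is first treated as a separate argument
-- and only then replaced by `b xs`.
instantiateᴿ : {F : Vec ℕ (suc n) → ℕ} {b : Vec ℕ n → ℕ} → Recursive F → Recursive b →
               Recursive (λ xs → F (b xs ∷ xs))
instantiateᴿ {F = F} {b} Fᴿ bᴿ =
  extᴿ (λ xs → cong (λ z → F (b xs ∷ z)) (tabulate∘lookup xs))
       (compᴿ {g = λ { zero → b ; (suc i) xs → lookup xs i }} Fᴿ (λ { zero → bᴿ ; (suc i) → projᴿ i }))

x₀ : Recursive {suc n} (λ xs → lookup xs zero)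
x₀ = projᴿ zero

x₁ : Recursive {suc (suc n)} (λ xs → lookup xs (suc zero))
x₁ = projᴿ (suc zero)

x₂ : Recursive {suc (suc (suc n))} (λ xs → lookup xs (suc (suc zero)))
x₂ = projᴿ (suc (suc zero))

x₃ : Recursive {suc (suc (suc (suc n)))} (λ xs → lookup xs (suc (suc (suc zero))))
x₃ = projᴿ (suc (suc (suc zero)))

sucᴿ′ : {f : Vec ℕ n → ℕ} → Recursive f → Recursive (λ xs → suc (f xs))
sucᴿ′ fᴿ = comp₁ sucᴿ fᴿ

constᴿ : ∀ k → Recursive {n} (λ _ → k)
constᴿ zero    = compᴿ {g = λ ()} zeroᴿ (λ ())
constᴿ (suc k) = sucᴿ′ (constᴿ k)

predᴿ : {f : Vec ℕ n → ℕ} → Recursive f → Recursive (λ xs → pred (f xs))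
predᴿ = comp₁ {f = λ xs → pred (lookup xs zero)}
  (natrecᴿ (constᴿ 0) x₀ (λ { [] → refl }) (λ { _ [] → refl }))

module _ {f g : Vec ℕ n → ℕ} (fᴿ : Recursive f) (gᴿ : Recursive g) where

  +ᴿ : Recursive (λ xs → f xs + g xs)
  +ᴿ = comp₂ {f = λ xs → lookup xs zero + lookup xs (suc zero)}
    (natrecᴿ x₀ (sucᴿ′ x₁) (λ { (_ ∷ []) → refl }) (λ { _ (_ ∷ []) → refl })) fᴿ gᴿ

  ∸ᴿ : Recursive (λ xs → f xs ∸ g xs)
  ∸ᴿ = comp₂ {f = λ xs → lookup xs (suc zero) ∸ lookup xs zero}
    (natrecᴿ x₀ (predᴿ x₁) (λ { (_ ∷ []) → refl })
      (λ { y (x ∷ []) → sym (pred[m∸n]≡m∸[1+n] x y) })) gᴿ fᴿ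

module _ {f g : Vec ℕ n → ℕ} (fᴿ : Recursive f) (gᴿ : Recursive g) where

  *ᴿ : Recursive (λ xs → f xs * g xs)
  *ᴿ = comp₂ {f = λ xs → lookup xs zero * lookup xs (suc zero)}
    (natrecᴿ (constᴿ 0) (+ᴿ x₂ x₁) (λ { (_ ∷ []) → refl }) (λ { _ (_ ∷ []) → refl })) fᴿ gᴿ

  ⊓ᴿ : Recursive (λ xs → f xs ⊓ g xs)
  ⊓ᴿ = extᴿ (λ xs → eq (f xs) (g xs)) (∸ᴿ gᴿ (∸ᴿ gᴿ fᴿ))
    where
    eq : ∀ a b → b ∸ (b ∸ a) ≡ a ⊓ b
    eq a b = trans (cong (_∸ (b ∸ a)) (sym (m⊓n+n∸m≡n a b))) (m+n∸n≡m (a ⊓ b) (b ∸ a))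

  <ᵇᴿ : Decᴿ (λ xs → f xs <ᵇ g xs)
  <ᵇᴿ = extᴿ (λ xs → eq (f xs) (g xs)) (∸ᴿ (constᴿ 1) (∸ᴿ (constᴿ 1) (∸ᴿ gᴿ fᴿ)))
    where
    eq : ∀ a b → 1 ∸ (1 ∸ (b ∸ a)) ≡ ⟦ a <ᵇ b ⟧
    eq zero    zero    = refl
    eq zero    (suc b) = cong (1 ∸_) (0∸n≡0 b)
    eq (suc a) zero    = refl
    eq (suc a) (suc b) = eq a b

  ≡ᵇᴿ : Decᴿ (λ xs → f xs ≡ᵇ g xs)
  ≡ᵇᴿ = extᴿ (λ xs → eq (f xs) (g xs)) (∸ᴿ (constᴿ 1) (+ᴿ (∸ᴿ fᴿ gᴿ) (∸ᴿ gᴿ fᴿ)))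
    where
    eq : ∀ a b → 1 ∸ ((a ∸ b) + (b ∸ a)) ≡ ⟦ a ≡ᵇ b ⟧
    eq zero    zero    = refl
    eq zero    (suc b) = 0∸n≡0 b
    eq (suc a) zero    = trans (cong (1 ∸_) (+-identityʳ (suc a))) (0∸n≡0 a)
    eq (suc a) (suc b) = eq a b

notᴿ : {p : Vec ℕ n → Bool} → Decᴿ p → Decᴿ (λ xs → not (p xs))
notᴿ {p = p} pᴿ = extᴿ (λ xs → eq (p xs)) (∸ᴿ (constᴿ 1) pᴿ)
  where
  eq : ∀ a → 1 ∸ ⟦ a ⟧ ≡ ⟦ not a ⟧
  eq true  = refl
  eq false = refl

module _ {p q : Vec ℕ n → Bool} (pᴿ : Decᴿ p) where

  ∧ᴿ : Decᴿ q → Decᴿ (λ xs → p xs ∧ q xs)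
  ∧ᴿ qᴿ = extᴿ (λ xs → eq (p xs) (q xs)) (*ᴿ pᴿ qᴿ)
    where
    eq : ∀ a b → ⟦ a ⟧ * ⟦ b ⟧ ≡ ⟦ a ∧ b ⟧
    eq true  b = +-identityʳ ⟦ b ⟧
    eq false b = refl

  ∨ᴿ : Decᴿ q → Decᴿ (λ xs → p xs ∨ q xs)
  ∨ᴿ qᴿ = extᴿ (λ xs → eq (p xs) (q xs)) (∸ᴿ (+ᴿ pᴿ qᴿ) (*ᴿ pᴿ qᴿ))
    where
    eq : ∀ a b → ⟦ a ⟧ + ⟦ b ⟧ ∸ ⟦ a ⟧ * ⟦ b ⟧ ≡ ⟦ a ∨ b ⟧
    eq true  true  = refl
    eq true  false = refl
    eq false b     = refl

ifᴿ : {p : Vec ℕ n → Bool} {f g : Vec ℕ n → ℕ} → Decᴿ p → Recursive f → Recursive g →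
      Recursive (λ xs → if p xs then f xs else g xs)
ifᴿ {p = p} {f} {g} pᴿ fᴿ gᴿ =
  extᴿ (λ xs → eq (p xs) (f xs) (g xs)) (+ᴿ (*ᴿ pᴿ fᴿ) (*ᴿ (∸ᴿ (constᴿ 1) pᴿ) gᴿ))
  where
  eq : ∀ a x y → ⟦ a ⟧ * x + (1 ∸ ⟦ a ⟧) * y ≡ (if a then x else y)
  eq true  x y = trans (+-identityʳ (x + 0)) (+-identityʳ x)
  eq false x y = +-identityʳ y

-- The step function of a recursion receives the counter, the previous value and the parameters.
-- Here the previous value is ignored; `skip₀` ignores the counter instead, as needed for `least`,
-- which tests its previous value.
skip₁ : {f : Vec ℕ (suc n) → ℕ} → Recursive f → Recursive (λ ys → f (head ys ∷ tail (tail ys)))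
skip₁ {f = f} fᴿ = extᴿ (λ { (y ∷ z ∷ xs) → cong (λ w → f (y ∷ w)) (tabulate∘lookup xs) })
  (compᴿ {g = λ { zero xs → lookup xs zero ; (suc i) xs → lookup xs (suc (suc i)) }} fᴿ
         (λ { zero → x₀ ; (suc i) → projᴿ (suc (suc i)) }))

skip₀ : {f : Vec ℕ (suc n) → ℕ} → Recursive f → Recursive {suc (suc n)} (f ∘ tail)
skip₀ {f = f} fᴿ = extᴿ (λ { (y ∷ z ∷ xs) → cong (λ w → f (z ∷ w)) (tabulate∘lookup xs) })
  (compᴿ {g = λ { zero xs → lookup xs (suc zero) ; (suc i) xs → lookup xs (suc (suc i)) }} fᴿ
         (λ { zero → x₁ ; (suc i) → projᴿ (suc (suc i)) }))

∑ᴿ : {f : Vec ℕ (suc n) → ℕ} {b : Vec ℕ n → ℕ} → Recursive f → Recursive b →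
     Recursive (λ xs → ∑ (b xs) (λ i → f (i ∷ xs)))
∑ᴿ {f = f} fᴿ bᴿ = instantiateᴿ {F = λ { (k ∷ xs) → ∑ k (λ i → f (i ∷ xs)) }}
  (natrecᴿ (constᴿ 0) (+ᴿ x₁ (skip₁ fᴿ)) (λ _ → refl) (λ _ _ → refl)) bᴿ

module _ {p : Vec ℕ (suc n) → Bool} {b : Vec ℕ n → ℕ} (pᴿ : Decᴿ p) (bᴿ : Recursive b) where

  anyᴿ : Decᴿ (λ xs → anyBelow (b xs) (λ i → p (i ∷ xs)))
  anyᴿ = extᴿ (λ xs → eq (b xs) (λ i → p (i ∷ xs))) (<ᵇᴿ (constᴿ 0) (∑ᴿ pᴿ bᴿ))
    where
    eq : ∀ k q → ⟦ 0 <ᵇ count k q ⟧ ≡ ⟦ anyBelow k q ⟧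
    eq zero    q = refl
    eq (suc k) q with anyBelow k q | eq k q | q k
    ... | true | e | c with count k q
    ...   | suc _ = refl
    eq (suc k) q | false | e | c with count k q
    eq (suc k) q | false | e | true  | zero = refl
    eq (suc k) q | false | e | false | zero = refl

  allᴿ : Decᴿ (λ xs → allBelow (b xs) (λ i → p (i ∷ xs)))
  allᴿ = instantiateᴿ {F = λ { (k ∷ xs) → ⟦ allBelow k (λ i → p (i ∷ xs)) ⟧ }}
    (natrecᴿ (constᴿ 1) (*ᴿ x₁ (skip₁ pᴿ)) (λ _ → refl)
      (λ k xs → eq (allBelow k (λ i → p (i ∷ xs))) (p (k ∷ xs)))) bᴿ
    where
    eq : ∀ a b → ⟦ a ∧ b ⟧ ≡ ⟦ a ⟧ * ⟦ b ⟧
    eq true  b = sym (+-identityʳ ⟦ b ⟧)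
    eq false b = refl

  leastᴿ : Recursive (λ xs → least (b xs) (λ i → p (i ∷ xs)))
  leastᴿ = instantiateᴿ {F = λ { (k ∷ xs) → least k (λ i → p (i ∷ xs)) }}
    (natrecᴿ (constᴿ 0) (ifᴿ {p = p ∘ tail} (skip₀ pᴿ) x₁ (sucᴿ′ x₀))
      (λ _ → refl) (λ _ _ → refl)) bᴿ

2^ᴿ : {f : Vec ℕ n → ℕ} → Recursive f → Recursive (λ xs → 2 ^ f xs)
2^ᴿ fᴿ = comp₁ {f = λ xs → 2 ^ lookup xs zero}
  (natrecᴿ (constᴿ 1) (*ᴿ (constᴿ 2) x₁) (λ { [] → refl }) (λ { _ [] → refl })) fᴿ

bitᴿ : {f g : Vec ℕ n → ℕ} → Recursive f → Recursive g → Decᴿ (λ xs → bit (f xs) (g xs))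
bitᴿ fᴿ gᴿ = comp₁ {f = λ xs → ⟦ odd (lookup xs zero) ⟧} oddᴿ (comp₂ halvesᴿ fᴿ gᴿ)
  where
  oddᴿ : Decᴿ {1} (λ xs → odd (lookup xs zero))
  oddᴿ = natrecᴿ (constᴿ 0) (∸ᴿ (constᴿ 1) x₁) (λ { [] → refl }) (λ { y [] → eq (odd y) })
    where
    eq : ∀ a → ⟦ not a ⟧ ≡ 1 ∸ ⟦ a ⟧
    eq true  = refl
    eq false = refl
  halfᴿ : Recursive {1} (λ xs → half (lookup xs zero))
  halfᴿ = natrecᴿ (constᴿ 0) (+ᴿ x₁ (comp₁ oddᴿ x₀)) (λ { [] → refl }) (λ { _ [] → refl })
  halvesᴿ : Recursive {2} (λ xs → halves (lookup xs zero) (lookup xs (suc zero)))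
  halvesᴿ = natrecᴿ x₀ (comp₁ halfᴿ x₁) (λ { (_ ∷ []) → refl }) (λ { _ (_ ∷ []) → refl })

∑-mono-< : ∀ {n u} f g → (∀ i → i < n → f i ≤ g i) → u < n → f u < g u → ∑ n f < ∑ n g
∑-mono-< {suc n} f g f≤g u<1+n fu<gu with ≤-suc-split u<1+n
... | inj₁ u<n  = +-mono-<-≤ (∑-mono-< f g (λ i i<n → f≤g i (m≤n⇒m≤1+n i<n)) u<n fu<gu) (f≤g n ≤-refl)
... | inj₂ refl = +-mono-≤-< (∑-mono n (λ i i<n → f≤g i (m≤n⇒m≤1+n i<n))) fu<gu

-- Weighted Hall condition

weight : ℕ → (ℕ → ℕ) → (ℕ → Bool) → ℕ
weight L r X = ∑ L (λ x → ⟦ X x ⟧ * r x)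

module Neighbours (e : ℕ → ℕ → Bool) where

  nbr : ℕ → (ℕ → Bool) → ℕ → Bool
  nbr L X w = anyBelow L (λ x → X x ∧ e x w)

  -- With `r x` the number of children still owed to `x` and `a` the vertices still available,
  -- Hall's condition for `X` reads `weight L r X ≤ reach W a L X`. The numbers `L` and `W` bound
  -- the two sides of the graph.
  reach : ℕ → (ℕ → Bool) → ℕ → (ℕ → Bool) → ℕ
  reach W a L X = count W (λ w → a w ∧ nbr L X w)

  nbr-elim : ∀ L X {w} → T (nbr L X w) → ∃[ x ] x < L × T (X x) × T (e x w)
  nbr-elim L X t =
    let x , x<L , t′ = any-elim L _ t ; Xx , exw = ∧-elim t′ in x , x<L , Xx , exw

  nbr-intro : ∀ {L x w} X → x < L → T (X x) → T (e x w) → T (nbr L X w)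
  nbr-intro X x<L Xx exw = any-intro _ x<L (∧-intro Xx exw)

  nbr-mono : ∀ L X Y {w} → (∀ x → T (X x) → T (Y x)) → T (nbr L X w) → T (nbr L Y w)
  nbr-mono L X Y X⊆Y t = let x , x<L , Xx , exw = nbr-elim L X t in nbr-intro Y x<L (X⊆Y x Xx) exw

  remove : (ℕ → Bool) → ℕ → ℕ → Bool
  remove a v w = a w ∧ not (w ≡ᵇ v)

  -- If no admissible v exists then every available neighbour v of u lies in
  -- N(X) for some tight set X avoiding u.  Tight sets are closed under union
  -- by submodularity, so a single tight Z has N(u) ⊆ N(Z), and Z ∪ {u}
  -- violates the Hall condition.
  module _ (L W : ℕ) (e-bound : ∀ {x w} → x < L → T (e x w) → w < W)
           (a : ℕ → Bool) (r r′ : ℕ → ℕ) (u : ℕ) (u<L : u < L)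
           (r-u : r u ≡ suc (r′ u)) (r-other : ∀ x → x ≢ u → r x ≡ r′ x)
           (hall : ∀ X → weight L r X ≤ reach W a L X)
    where

    private
      Tight : (ℕ → Bool) → Set
      Tight X = ¬ T (X u) × reach W a L X ≤ weight L r X

      r′≤r : ∀ x → r′ x ≤ r x
      r′≤r x with x ≟ u
      ... | yes refl = subst (r′ u ≤_) (sym r-u) (n≤1+n (r′ u))
      ... | no  x≢u  = ≤-reflexive (sym (r-other x x≢u))

      weight-≤ : ∀ X → weight L r′ X ≤ weight L r X
      weight-≤ X = ∑-mono L (λ x _ → *-monoʳ-≤ ⟦ X x ⟧ (r′≤r x))

      reach-remove : ∀ v X → reach W a L X ≤ suc (reach W (remove a v) L X)
      reach-remove v X = begin
        reach W a L X                                       ≤⟨ ∑-mono W (λ w _ → pointwise (a w) (nbr L X w) (w ≡ᵇ v)) ⟩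
        ∑ W (λ w → ⟦ remove a v w ∧ nbr L X w ⟧ + ⟦ w ≡ᵇ v ⟧) ≡⟨ ∑-+ W _ _ ⟩
        reach W (remove a v) L X + count W (_≡ᵇ v)          ≤⟨ +-monoʳ-≤ _ (count-singleton W v) ⟩
        reach W (remove a v) L X + 1                        ≡⟨ +-comm _ 1 ⟩
        suc (reach W (remove a v) L X)                      ∎
        where
        open ≤-Reasoning
        pointwise : ∀ x y z → ⟦ x ∧ y ⟧ ≤ ⟦ (x ∧ not z) ∧ y ⟧ + ⟦ z ⟧
        pointwise false _     _     = z≤n
        pointwise true  false _     = z≤n
        pointwise true  true  true  = ≤-refl
        pointwise true  true  false = ≤-refl

      -- Losing `v` costs `X` at most one neighbour, so `weight r X ≤ reach a X ≤ 1 + reach (remove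
      -- a v) X ≤ weight r′ X ≤ weight r X` are all equalities. The last would be strict if `u` were
      -- in `X`, and if `v` were outside `N(X)` nothing would be lost at all.
      critical⇒tight : ∀ v X → reach W (remove a v) L X < weight L r′ X → Tight X × T (nbr L X v)
      critical⇒tight v X critical = (u∉X , tight) , v∈nbr
        where
        open ≤-Reasoning
        u∉X : ¬ T (X u)
        u∉X u∈X = <-irrefl refl (begin-strict
          weight L r X                   ≤⟨ hall X ⟩
          reach W a L X                  ≤⟨ reach-remove v X ⟩
          suc (reach W (remove a v) L X) ≤⟨ critical ⟩
          weight L r′ X                  <⟨ ∑-mono-< _ _ (λ x _ → *-monoʳ-≤ ⟦ X x ⟧ (r′≤r x)) u<L at-u ⟩
          weight L r X                   ∎)
          where
          at-u : ⟦ X u ⟧ * r′ u < ⟦ X u ⟧ * r u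
          at-u rewrite ⟦T⟧ u∈X | r-u = ≤-refl
        tight : reach W a L X ≤ weight L r X
        tight = ≤-trans (reach-remove v X) (≤-trans critical (weight-≤ X))
        v∈nbr : T (nbr L X v)
        v∈nbr with T-split (nbr L X v)
        ... | inj₁ t = t
        ... | inj₂ v∉nbr = ⊥-elim (<-irrefl refl (begin-strict
          weight L r X             ≤⟨ hall X ⟩
          reach W a L X            ≤⟨ ∑-mono W (λ w _ → ⟦⟧-mono (unaffected w)) ⟩
          reach W (remove a v) L X <⟨ critical ⟩
          weight L r′ X            ≤⟨ weight-≤ X ⟩
          weight L r X             ∎))
          where
          unaffected : ∀ w → T (a w ∧ nbr L X w) → T (remove a v w ∧ nbr L X w)
          unaffected w t = let aw , nw = ∧-elim {a w} t in
            ∧-intro {remove a v w}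
              (∧-intro aw (not-intro (λ w≡v → v∉nbr (subst (T ∘ nbr L X) (≡ᵇ⇒≡ w v w≡v) nw)))) nw

      union-tight : ∀ X Y → Tight X → Tight Y → Tight (λ x → X x ∨ Y x)
      union-tight X Y (u∉X , tX) (u∉Y , tY) = u∉X∪Y , +-cancelʳ-≤ (reach W a L X∩Y) _ _ (begin
        reach W a L X∪Y + reach W a L X∩Y ≡⟨ sym (∑-+ W _ _) ⟩
        ∑ W (λ w → ⟦ a w ∧ nbr L X∪Y w ⟧ + ⟦ a w ∧ nbr L X∩Y w ⟧)
          ≤⟨ ∑-mono W (λ w _ → submodular (a w) (nbr L X∪Y w) (nbr L X∩Y w) (nbr L X w) (nbr L Y w)
               (∪⊆ w) (nbr-mono L X∩Y X (λ x → proj₁ ∘ ∧-elim)) (nbr-mono L X∩Y Y (λ x → proj₂ ∘ ∧-elim {X x}))) ⟩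
        ∑ W (λ w → ⟦ a w ∧ nbr L X w ⟧ + ⟦ a w ∧ nbr L Y w ⟧) ≡⟨ ∑-+ W _ _ ⟩
        reach W a L X + reach W a L Y     ≤⟨ +-mono-≤ tX tY ⟩
        weight L r X + weight L r Y       ≡⟨ sym (∑-+ L _ _) ⟩
        ∑ L (λ x → ⟦ X x ⟧ * r x + ⟦ Y x ⟧ * r x) ≡⟨ ∑-cong L (λ x _ → modular (X x) (Y x) (r x)) ⟩
        ∑ L (λ x → ⟦ X∪Y x ⟧ * r x + ⟦ X∩Y x ⟧ * r x) ≡⟨ ∑-+ L _ _ ⟩
        -- Hall's condition for the intersection turns its weight into its reach, which then cancels
        -- against the left-hand side.
        weight L r X∪Y + weight L r X∩Y   ≤⟨ +-monoʳ-≤ _ (hall X∩Y) ⟩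
        weight L r X∪Y + reach W a L X∩Y  ∎)
        where
        open ≤-Reasoning
        X∪Y X∩Y : ℕ → Bool
        X∪Y x = X x ∨ Y x
        X∩Y x = X x ∧ Y x
        u∉X∪Y : ¬ T (X∪Y u)
        u∉X∪Y t with ∨-elim {X u} t
        ... | inj₁ l = u∉X l
        ... | inj₂ r = u∉Y r
        ∪⊆ : ∀ w → T (nbr L X∪Y w) → T (nbr L X w) ⊎ T (nbr L Y w)
        ∪⊆ w t with nbr-elim L X∪Y t
        ... | x , x<L , X∪Yx , exw with ∨-elim {X x} X∪Yx
        ...   | inj₁ Xx = inj₁ (nbr-intro X x<L Xx exw)
        ...   | inj₂ Yx = inj₂ (nbr-intro Y x<L Yx exw)
        submodular : ∀ b ∪ ∩ x y → (T ∪ → T x ⊎ T y) → (T ∩ → T x) → (T ∩ → T y) →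
                     ⟦ b ∧ ∪ ⟧ + ⟦ b ∧ ∩ ⟧ ≤ ⟦ b ∧ x ⟧ + ⟦ b ∧ y ⟧
        submodular false ∪ ∩ x y f g h = z≤n
        submodular true ∪ true x y f g h rewrite ⟦T⟧ (g tt) | ⟦T⟧ (h tt) =
          +-monoˡ-≤ 1 (⟦⟧-mono {∪} {true} _)
        submodular true false false x y f g h = z≤n
        submodular true true false x y f g h with f tt
        ... | inj₁ t rewrite ⟦T⟧ t = s≤s z≤n
        ... | inj₂ t rewrite ⟦T⟧ t = m≤n+m 1 ⟦ x ⟧
        modular : ∀ x y c → ⟦ x ⟧ * c + ⟦ y ⟧ * c ≡ ⟦ x ∨ y ⟧ * c + ⟦ x ∧ y ⟧ * c
        modular true  y     c = refl
        modular false true  c = +-comm 0 (c + 0)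
        modular false false c = refl

      empty-tight : Tight (λ _ → false)
      empty-tight = (λ ()) , ≤-trans (≤-reflexive
        (∑-≡0 W (λ w _ → ⟦¬T⟧ (λ t → proj₁ (proj₂ (proj₂ (nbr-elim L (λ _ → false) {w} (proj₂ (∧-elim {a w} {nbr L (λ _ → false) w} t)))))))))
        z≤n

      module _ {Good : ℕ → Set}
               (decide : ∀ v → T (a v) → Good v ⊎ ∃[ X ] reach W (remove a v) L X < weight L r′ X)
        where

        -- The scan keeps a single tight set whose neighbourhood covers all candidates rejected so
        -- far; each new rejection enlarges it by a union.
        search : ∀ k → (∃[ v ] T (e u v) × T (a v) × Good v) ⊎
                       (∃[ Z ] Tight Z × (∀ v → v < k → T (e u v) → T (a v) → T (nbr L Z v)))
        search zero = inj₂ ((λ _ → false) , empty-tight , λ _ ())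
        search (suc k) with search k
        ... | inj₁ found = inj₁ found
        ... | inj₂ (Z , tZ , cover) with T-split (e u k) | T-split (a k)
        ...   | inj₂ ¬euk | _ = inj₂ (Z , tZ , λ v v<1+k euv av →
                  cover v (≤∧≢⇒< (≤-pred v<1+k) (λ { refl → ¬euk euv })) euv av)
        ...   | inj₁ _ | inj₂ ¬ak = inj₂ (Z , tZ , λ v v<1+k euv av →
                  cover v (≤∧≢⇒< (≤-pred v<1+k) (λ { refl → ¬ak av })) euv av)
        ...   | inj₁ euk | inj₁ ak with decide k ak
        ...     | inj₁ good = inj₁ (k , euk , ak , good)
        ...     | inj₂ (X , critical) with critical⇒tight k X critical
        ...       | tX , k∈X = inj₂ ((λ x → Z x ∨ X x) , union-tight Z X tZ tX , cover′)
          where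
          cover′ : ∀ v → v < suc k → T (e u v) → T (a v) → T (nbr L (λ x → Z x ∨ X x) v)
          cover′ v v<1+k euv av with ≤-suc-split v<1+k
          ... | inj₁ v<k  = nbr-mono L Z _ (λ x → ∨-introˡ) (cover v v<k euv av)
          ... | inj₂ refl = nbr-mono L X _ (λ x → ∨-introʳ {Z x}) k∈X

    hall-step : {Good : ℕ → Set} →
      (∀ v → T (a v) → Good v ⊎ ∃[ X ] reach W (remove a v) L X < weight L r′ X) →
      ∃[ v ] T (e u v) × T (a v) × Good v
    hall-step decide with search decide W
    ... | inj₁ found = found
    ... | inj₂ (Z , (u∉Z , tZ) , cover) = ⊥-elim (<-irrefl refl (begin-strict
        weight L r Z      <⟨ ∑-mono-< _ _ (λ x _ → *-monoˡ-≤ (r x) (⟦⟧-mono {Z x} ∨-introˡ)) u<L at-u ⟩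
        weight L r Z+u    ≤⟨ hall Z+u ⟩
        reach W a L Z+u   ≤⟨ ∑-mono W (λ w _ → ⟦⟧-mono (absorb w)) ⟩
        reach W a L Z     ≤⟨ tZ ⟩
        weight L r Z      ∎))
      where
      open ≤-Reasoning
      Z+u : ℕ → Bool
      Z+u x = Z x ∨ (x ≡ᵇ u)
      at-u : ⟦ Z u ⟧ * r u < ⟦ Z+u u ⟧ * r u
      at-u rewrite ⟦¬T⟧ u∉Z | ⟦T⟧ (∨-introʳ {Z u} (≡⇒≡ᵇ u u refl)) | r-u = s≤s z≤n
      absorb : ∀ w → T (a w ∧ nbr L Z+u w) → T (a w ∧ nbr L Z w)
      absorb w t with ∧-elim {a w} t
      ... | aw , nw with nbr-elim L Z+u nw
      ...   | x , x<L , Z+ux , exw with ∨-elim {Z x} Z+ux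
      ...     | inj₁ Zx = ∧-intro aw (nbr-intro Z x<L Zx exw)
      ...     | inj₂ x≡u with ≡ᵇ⇒≡ x u x≡u
      ...       | refl = ∧-intro aw (cover w (e-bound u<L exw) exw aw)

-- Greedy choice of `d` children for every vertex

module Greedy
  (d : ℕ) (1≤d : 1 ≤ d)
  (e : ℕ → ℕ → Bool) (e-sym : ∀ {x y} → T (e x y) → T (e y x))
  (nb : ℕ → ℕ) (nb-bound : ∀ {x y} → T (e x y) → y < nb x)
  where

  open Neighbours e

  -- A sum is as good as a maximum for bounding the neighbours of all `x < b`; the summand `b` makes
  -- the function inflationary.
  β : ℕ → ℕ
  β b = b + ∑ b nb

  β-bound : ∀ {b x y} → x < b → T (e x y) → y < β b
  β-bound {b} x<b exy = <-≤-trans (nb-bound exy) (≤-trans (∑-term nb x<b) (m≤n+m _ b))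

  β-inflationary : ∀ b → b ≤ β b
  β-inflationary b = m≤m+n b _

  β-mono : ∀ {a b} → a ≤ b → β a ≤ β b
  β-mono a≤b = +-mono-≤ a≤b (∑-≤-bound nb a≤b)

  module Slots
    (h : ℕ → ℕ) (h-zero : h 0 ≡ 0)
    (expand : ∀ L X n → h n ≤ count L X → d * count L X + n ≤ count (β L) (nbr L X))
    where

    -- All vertices used up to slot `s` lie below `β (layer s 0)`. One step applies `β` twice
    -- because two vertices of `U` compete only through a common neighbour, that is, at distance
    -- two.
    layer : ℕ → ℕ → ℕ
    layer s zero    = suc (suc s)
    layer s (suc i) = β (β (layer s i))

    -- After slot `s` there are `suc s` used vertices. A set with at least `h (suc s)` elements has
    -- that many neighbours to spare, and a smaller set cannot meet all of `h (suc s)` layers.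
    top : ℕ → ℕ
    top s = layer s (h (suc s))

    -- The slots s with d * x ≤ s < d * suc x belong to x, and demand s x is
    -- the number of them that are ≥ s.
    demand : ℕ → ℕ → ℕ
    demand s x = (d * suc x ∸ s) ⊓ d

    -- The quotient of `s` by `d`.
    owner : ℕ → ℕ
    owner s = least (suc s) (λ u → s <ᵇ d * suc u)

    free : ℕ → ℕ → Bool
    free B w = not (bit w B)

    -- The Hall condition for the sets X below top s, which are coded by the
    -- numbers below 2 ^ top s.
    test : ℕ → ℕ → Bool
    test s B = allBelow (2 ^ top s) (λ X →
      weight (top s) (demand (suc s)) (λ x → bit x X) <ᵇ
      suc (reach (β (top s)) (free B) (top s) (λ x → bit x X)))

    good : ℕ → ℕ → ℕ → Bool
    good s B v = e (owner s) v ∧ (free B v ∧ test s (B + 2 ^ v))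

    -- The bound exceeds all neighbours of `owner s`, as `owner s ≤ s`. That the search succeeds for
    -- `B = used s` is `slot-good`.
    choose : ℕ → ℕ → ℕ
    choose s B = least (β (suc (suc s))) (good s B)

    -- The binary code of the set of vertices chosen for the slots below `s`; see `bit-insert` for
    -- the addition.
    used : ℕ → ℕ
    used zero    = 0
    used (suc s) = used s + 2 ^ choose s (used s)

    slot : ℕ → ℕ
    slot s = choose s (used s)

    n≤d*n : ∀ n → n ≤ d * n
    n≤d*n n = subst (_≤ d * n) (*-identityˡ n) (*-monoˡ-≤ n 1≤d)

    owner-upper : ∀ s → s < d * suc (owner s)
    owner-upper s = <ᵇ⇒< s _ (least-witness (λ u → s <ᵇ d * suc u) (n<1+n s) (<⇒<ᵇ (n≤d*n (suc s))))

    owner-≤ : ∀ s → owner s ≤ s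
    owner-≤ s = least-≤-witness (suc s) (λ u → s <ᵇ d * suc u) (<⇒<ᵇ (n≤d*n (suc s)))

    owner-lower : ∀ s → d * owner s ≤ s
    owner-lower s = go (owner s) refl
      where
      go : ∀ u → owner s ≡ u → d * u ≤ s
      go zero    _  = ≤-trans (≤-reflexive (*-zeroʳ d)) z≤n
      go (suc u) eq = ≮⇒≥ (λ s< → least-minimal (suc s) (λ u → s <ᵇ d * suc u) {u}
                             (subst (u <_) (sym eq) (n<1+n u)) (<⇒<ᵇ s<))

    owner-unique : ∀ {s x} → d * x ≤ s → s < d * suc x → owner s ≡ x
    owner-unique {s} {x} dx≤s s<dx′ with <-cmp (owner s) x
    ... | tri≈ _ o≡x _ = o≡x
    ... | tri< o<x _ _ = contradiction (≤-trans (*-monoʳ-≤ d o<x) dx≤s) (<⇒≱ (owner-upper s))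
    ... | tri> _ _ x<o = contradiction (≤-trans (*-monoʳ-≤ d x<o) (owner-lower s)) (<⇒≱ s<dx′)

    demand-owner : ∀ s → demand s (owner s) ≡ suc (demand (suc s) (owner s))
    demand-owner s = begin
      (d * suc u ∸ s) ⊓ d               ≡⟨ m≤n⇒m⊓n≡m remaining≤d ⟩
      d * suc u ∸ s                     ≡⟨ +-∸-assoc 1 (owner-upper s) ⟩
      suc (d * suc u ∸ suc s)           ≡⟨ cong suc (sym (m≤n⇒m⊓n≡m (≤-trans (∸-monoʳ-≤ (d * suc u) (n≤1+n s)) remaining≤d))) ⟩
      suc ((d * suc u ∸ suc s) ⊓ d)     ∎
      where
      open ≡-Reasoning
      u = owner s
      remaining≤d : d * suc u ∸ s ≤ d
      remaining≤d = m≤n+o⇒m∸n≤o (d * suc u) s (subst (_≤ s + d) (sym (trans (*-suc d u) (+-comm d (d * u)))) (+-monoˡ-≤ d (owner-lower s)))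

    -- Neither `s` nor `suc s` falls strictly inside the block of another vertex: an earlier block
    -- is finished and demands 0, a later one is untouched and demands `d`.
    demand-other : ∀ s x → x ≢ owner s → demand s x ≡ demand (suc s) x
    demand-other s x x≢u with <-cmp x (owner s)
    ... | tri≈ _ x≡u _ = contradiction x≡u x≢u
    ... | tri< x<u _ _ = trans (cong (_⊓ d) (m≤n⇒m∸n≡0 le)) (sym (cong (_⊓ d) (m≤n⇒m∸n≡0 (m≤n⇒m≤1+n le))))
      where
      le : d * suc x ≤ s
      le = ≤-trans (*-monoʳ-≤ d x<u) (owner-lower s)
    ... | tri> _ _ u<x = trans (m≥n⇒m⊓n≡n (≤-trans ge (∸-monoʳ-≤ (d * suc x) (n≤1+n s)))) (sym (m≥n⇒m⊓n≡n ge))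
      where
      ge : d ≤ d * suc x ∸ suc s
      ge = m+n≤o⇒m≤o∸n d (subst (d + suc s ≤_) (sym (*-suc d x))
             (+-monoʳ-≤ d (≤-trans (owner-upper s) (*-monoʳ-≤ d u<x))))

    weight-demand : ∀ L s X → weight L (demand s) X ≤ d * count L X
    weight-demand L s X = ≤-trans
      (∑-mono L (λ x _ → ≤-trans (*-monoʳ-≤ ⟦ X x ⟧ (m⊓n≤n (d * suc x ∸ s) d)) (≤-reflexive (*-comm ⟦ X x ⟧ d))))
      (≤-reflexive (∑-*ˡ L d _))

    layer-mono : ∀ s {i j} → i ≤ j → layer s i ≤ layer s j
    layer-mono s {i} {zero}  z≤n = ≤-refl
    layer-mono s {i} {suc j} i≤1+j with m≤n⇒m<n∨m≡n i≤1+j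
    ... | inj₂ refl  = ≤-refl
    ... | inj₁ i<1+j = ≤-trans (layer-mono s (≤-pred i<1+j)) (≤-trans (β-inflationary _) (β-inflationary _))

    -- For a truncated set the bounds in `weight` and `reach` may be enlarged freely, so Hall's
    -- condition can be moved between different `L`.
    cut : (ℕ → Bool) → ℕ → ℕ → Bool
    cut X L x = X x ∧ (x <ᵇ L)

    weight-cut : ∀ {L L′} r X → L ≤ L′ → weight L′ r (cut X L) ≡ weight L r X
    weight-cut {L} r X L≤L′ = trans
      (∑-support _ L≤L′ (λ x L≤x → cong (_* r x) (⟦¬T⟧ (λ t → ≤⇒≯ L≤x (<ᵇ⇒< x L (proj₂ (∧-elim {X x} t)))))))
      (∑-cong L (λ x x<L → cong (λ b → ⟦ b ⟧ * r x)
        (T-ext (proj₁ ∘ ∧-elim {X x}) (λ Xx → ∧-intro Xx (<⇒<ᵇ x<L)))))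

    nbr-cut : ∀ {L L′} X w → L ≤ L′ → nbr L′ (cut X L) w ≡ nbr L X w
    nbr-cut {L} {L′} X w L≤L′ = T-ext shrink extend
      where
      shrink : T (nbr L′ (cut X L) w) → T (nbr L X w)
      shrink t =
        let x , _ , cutx , exw = nbr-elim L′ (cut X L) t ; Xx , x<L = ∧-elim {X x} cutx
        in nbr-intro X (<ᵇ⇒< x L x<L) Xx exw
      extend : T (nbr L X w) → T (nbr L′ (cut X L) w)
      extend t =
        let x , x<L , Xx , exw = nbr-elim L X t
        in nbr-intro (cut X L) (<-≤-trans x<L L≤L′) (∧-intro Xx (<⇒<ᵇ x<L)) exw

    reach-cut : ∀ {L L′} a X → L ≤ L′ → reach (β L′) a L′ (cut X L) ≡ reach (β L) a L X
    reach-cut {L} {L′} a X L≤L′ = trans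
      (∑-cong (β L′) (λ w _ → cong (λ b → ⟦ a w ∧ b ⟧) (nbr-cut X w L≤L′)))
      (∑-support _ (β-mono L≤L′) (λ w βL≤w → ⟦¬T⟧ (λ t →
        let x , x<L , Xx , exw = nbr-elim L X (proj₂ (∧-elim {a w} t)) in ≤⇒≯ βL≤w (β-bound x<L exw))))

    module Extend (s B : ℕ)
      (B-bound : ∀ {w} → T (bit w B) → w < β (suc (suc s)))
      (B-size : ∀ W → count W (λ w → bit w B) ≤ suc s)
      (local : ∀ X → weight (top s) (demand (suc s)) X ≤ reach (β (top s)) (free B) (top s) X)
      where

      -- The expanding condition gives `X` a surplus of `suc s` neighbours, and `B` can take away no
      -- more than that.
      large : ∀ L X → h (suc s) ≤ count L X → weight L (demand (suc s)) X ≤ reach (β L) (free B) L X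
      large L X h≤ = +-cancelʳ-≤ (suc s) _ _ (begin
        weight L (demand (suc s)) X + suc s              ≤⟨ +-monoˡ-≤ (suc s) (weight-demand L (suc s) X) ⟩
        d * count L X + suc s                            ≤⟨ expand L X (suc s) h≤ ⟩
        count (β L) (nbr L X)                            ≤⟨ ∑-mono (β L) (λ w _ → pointwise (bit w B) (nbr L X w)) ⟩
        ∑ (β L) (λ w → ⟦ free B w ∧ nbr L X w ⟧ + ⟦ bit w B ⟧) ≡⟨ ∑-+ (β L) _ _ ⟩
        reach (β L) (free B) L X + count (β L) (λ w → bit w B) ≤⟨ +-monoʳ-≤ _ (B-size (β L)) ⟩
        reach (β L) (free B) L X + suc s                 ∎)
        where
        open ≤-Reasoning
        pointwise : ∀ b n → ⟦ n ⟧ ≤ ⟦ not b ∧ n ⟧ + ⟦ b ⟧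
        pointwise true  n = ⟦⟧-mono {n} {true} _
        pointwise false n = m≤m+n ⟦ n ⟧ 0

      Gap : (ℕ → Bool) → ℕ → Set
      Gap X j = ∀ x → layer s j ≤ x → x < layer s (suc j) → ¬ T (X x)

      -- Each layer that is not a gap contributes an element of its own to `X`.
      find-gap : ∀ X i → i ≤ count (layer s i) X ⊎ ∃[ j ] j < i × Gap X j
      find-gap X zero = inj₁ z≤n
      find-gap X (suc i) with find-gap X i
      ... | inj₂ (j , j<i , gap) = inj₂ (j , m≤n⇒m≤1+n j<i , gap)
      ... | inj₁ i≤ with T-split (anyBelow (layer s (suc i)) (λ x → X x ∧ not (x <ᵇ layer s i)))
      ...   | inj₂ none = inj₂ (i , ≤-refl , λ x l≤x x<l Xx →
                none (any-intro _ x<l (∧-intro Xx (not-intro (λ t → ≤⇒≯ l≤x (<ᵇ⇒< x _ t))))))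
      ...   | inj₁ some with any-elim (layer s (suc i)) (λ x → X x ∧ not (x <ᵇ layer s i)) some
      ...     | x , x<l , t with ∧-elim {X x} t
      ...       | Xx , l≰x = inj₁ (begin
        suc i                             ≤⟨ s≤s i≤ ⟩
        suc (count (layer s i) X)         ≤⟨ s≤s (∑-≤-bound (λ x → ⟦ X x ⟧) li≤x) ⟩
        suc (count x X)                   ≡⟨ +-comm 1 (count x X) ⟩
        count x X + 1                     ≡⟨ cong (count x X +_) (sym (⟦T⟧ Xx)) ⟩
        count (suc x) X                   ≤⟨ ∑-≤-bound _ x<l ⟩
        count (layer s (suc i)) X         ∎)
        where
        open ≤-Reasoning
        li≤x : layer s i ≤ x
        li≤x = ≮⇒≥ (λ x<li → not-elim {x <ᵇ layer s i} l≰x (<⇒<ᵇ x<li))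

      -- With Y the part of X below the gap and Z the part above it, N(Z) meets
      -- neither N(Y) nor B.
      split : ∀ L X → top s ≤ L → ∀ j → j ≤ h (suc s) → Gap X j →
              weight L (demand (suc s)) X ≤ reach (β L) (free B) L X
      split L X top≤L j j≤h gap = begin
        weight L r X                               ≡⟨ ∑-cong L (λ x _ → divide (X x) (x <ᵇ l) (r x)) ⟩
        ∑ L (λ x → ⟦ Y x ⟧ * r x + ⟦ Z x ⟧ * r x)  ≡⟨ ∑-+ L _ _ ⟩
        weight L r Y + weight L r Z                ≤⟨ +-mono-≤ lower upper ⟩
        reach (β L) a L Y + count (β L) (nbr L Z)  ≡⟨ sym (∑-+ (β L) _ _) ⟩
        ∑ (β L) (λ w → ⟦ a w ∧ nbr L Y w ⟧ + ⟦ nbr L Z w ⟧)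
          ≤⟨ ∑-mono (β L) (λ w _ → disjoint (a w) (nbr L Y w) (nbr L Z w) (nbr L X w)
               (nbr-mono L Y X (λ x → proj₁ ∘ ∧-elim)) (nbr-mono L Z X (λ x → proj₁ ∘ ∧-elim))
               (Z-free w) (Z-avoids-Y w)) ⟩
        reach (β L) a L X                          ∎
        where
        open ≤-Reasoning
        r = demand (suc s)
        a = free B
        l = layer s j
        Y Z : ℕ → Bool
        Y = cut X l
        Z x = X x ∧ not (x <ᵇ l)
        l≤top : l ≤ top s
        l≤top = layer-mono s j≤h
        divide : ∀ x b c → ⟦ x ⟧ * c ≡ ⟦ x ∧ b ⟧ * c + ⟦ x ∧ not b ⟧ * c
        divide false b     c = refl
        divide true  true  c = sym (+-identityʳ (c + 0))
        divide true  false c = refl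
        lower : weight L r Y ≤ reach (β L) a L Y
        lower = begin
          weight L r Y                       ≡⟨ weight-cut r X (≤-trans l≤top top≤L) ⟩
          weight l r X                       ≡⟨ sym (weight-cut r X l≤top) ⟩
          -- The part below the gap lies below `top s`, where the condition has been tested.
          weight (top s) r Y                 ≤⟨ local Y ⟩
          reach (β (top s)) a (top s) Y      ≡⟨ reach-cut a X l≤top ⟩
          reach (β l) a l X                  ≡⟨ sym (reach-cut a X (≤-trans l≤top top≤L)) ⟩
          reach (β L) a L Y                  ∎
        upper : weight L r Z ≤ count (β L) (nbr L Z)
        upper = ≤-trans (weight-demand L (suc s) Z)
          -- With surplus 0 the expanding condition is the plain harem condition, valid for every
          -- `Z` because `h 0 ≡ 0`.
          (≤-trans (m≤m+n _ 0) (expand L Z 0 (subst (_≤ count L Z) (sym h-zero) z≤n)))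
        Z-far : ∀ {w} → T (nbr L Z w) → ¬ w < β l
        Z-far {w} nZ w<βl with nbr-elim L Z {w} nZ
        ... | z , _ , Zz , ezw with ∧-elim {X z} Zz
        -- By symmetry of `e`, a neighbour `w < β l` would force `z < β (β l)`, which is the end of
        -- the gap.
        ...   | Xz , z≮l = gap z (≮⇒≥ (λ z<l → not-elim z≮l (<⇒<ᵇ z<l))) (β-bound w<βl (e-sym ezw)) Xz
        Z-free : ∀ w → T (nbr L Z w) → T (a w)
        Z-free w nZ = not-intro (λ w∈B → Z-far nZ (<-≤-trans (B-bound w∈B) (β-mono (layer-mono s {0} {j} z≤n))))
        Z-avoids-Y : ∀ w → T (nbr L Z w) → ¬ T (nbr L Y w)
        Z-avoids-Y w nZ nY with nbr-elim L Y {w} nY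
        ... | y , _ , Yy , eyw = Z-far nZ (β-bound (<ᵇ⇒< y l (proj₂ (∧-elim {X y} Yy))) eyw)
        disjoint : ∀ a y z x → (T y → T x) → (T z → T x) → (T z → T a) → (T z → ¬ T y) →
                   ⟦ a ∧ y ⟧ + ⟦ z ⟧ ≤ ⟦ a ∧ x ⟧
        disjoint a y false x f _ _ _ = ≤-trans (≤-reflexive (+-identityʳ ⟦ a ∧ y ⟧))
          (⟦⟧-mono {a ∧ y} (λ t → let ta , ty = ∧-elim {a} t in ∧-intro ta (f ty)))
        disjoint a true  true x _ _ _ k = ⊥-elim (k tt tt)
        disjoint false false true x     _ _ k _ = ⊥-elim (k tt)
        disjoint true  false true true  _ _ _ _ = ≤-refl
        disjoint true  false true false _ g _ _ = ⊥-elim (g tt)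

      global-above : ∀ L X → top s ≤ L → weight L (demand (suc s)) X ≤ reach (β L) (free B) L X
      global-above L X top≤L with <-≤-connex (count L X) (h (suc s))
      ... | inj₂ h≤ = large L X h≤
      ... | inj₁ <h with find-gap X (h (suc s))
      ...   | inj₂ (j , j<h , gap) = split L X top≤L j (<⇒≤ j<h) gap
      ...   | inj₁ h≤ = ⊥-elim (<⇒≱ <h (≤-trans h≤ (∑-≤-bound _ top≤L)))

      global : ∀ L X → weight L (demand (suc s)) X ≤ reach (β L) (free B) L X
      global L X = begin
        weight L (demand (suc s)) X            ≡⟨ sym (weight-cut _ X (m≤m+n L (top s))) ⟩
        weight L′ (demand (suc s)) (cut X L)   ≤⟨ global-above L′ (cut X L) (m≤n+m (top s) L) ⟩
        reach (β L′) (free B) L′ (cut X L)     ≡⟨ reach-cut (free B) X (m≤m+n L (top s)) ⟩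
        reach (β L) (free B) L X               ∎
        where
        open ≤-Reasoning
        L′ = L + top s

    -- `hall` ranges over all finite sets, which guarantees that the choice never gets stuck;
    -- `bound` and `size` are what `Extend` needs to recover it from the finite test.
    record Invariant (s : ℕ) : Set where
      field
        hall  : ∀ L X → weight L (demand s) X ≤ reach (β L) (free (used s)) L X
        bound : ∀ {w} → T (bit w (used s)) → w < β (suc s)
        size  : ∀ W → count W (λ w → bit w (used s)) ≤ s

    invariant-zero : Invariant 0
    invariant-zero = record
      { hall = λ L X → begin
          weight L (demand 0) X   ≤⟨ weight-demand L 0 X ⟩
          d * count L X           ≤⟨ m≤m+n _ 0 ⟩
          d * count L X + 0       ≤⟨ expand L X 0 (subst (_≤ count L X) (sym h-zero) z≤n) ⟩
          count (β L) (nbr L X)   ≤⟨ ∑-mono (β L) (λ w _ → ⟦⟧-mono (∧-intro (not-intro (bit-0 w)))) ⟩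
          reach (β L) (free 0) L X ∎
      ; bound = λ {w} t → ⊥-elim (bit-0 w t)
      ; size  = λ W → ≤-reflexive (∑-≡0 W (λ w _ → ⟦¬T⟧ (bit-0 w)))
      }
      where open ≤-Reasoning

    test-complete : ∀ s B → T (test s B) → ∀ X →
                    weight (top s) (demand (suc s)) X ≤ reach (β (top s)) (free B) (top s) X
    test-complete s B t X = begin
      weight (top s) (demand (suc s)) X                    ≡⟨ ∑-cong (top s) (λ x x<top → cong (λ b → ⟦ b ⟧ * demand (suc s) x) (sym (bit-encode X x<top))) ⟩
      weight (top s) (demand (suc s)) X′                   ≤⟨ ≤-pred (<ᵇ⇒< _ _ (all-elim _ t (encode-< (top s) X))) ⟩
      reach (β (top s)) (free B) (top s) X′                ≤⟨ ∑-mono (β (top s)) (λ w _ → ⟦⟧-mono (decode w)) ⟩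
      reach (β (top s)) (free B) (top s) X                 ∎
      where
      open ≤-Reasoning
      X′ : ℕ → Bool
      X′ x = bit x (encode (top s) X)
      decode : ∀ w → T (free B w ∧ nbr (top s) X′ w) → T (free B w ∧ nbr (top s) X w)
      decode w t with ∧-elim {free B w} t
      ... | fw , nw with nbr-elim (top s) X′ nw
      ...   | x , x<top , X′x , exw = ∧-intro fw (nbr-intro X x<top (subst T (bit-encode X x<top) X′x) exw)

    bit-used-suc : ∀ s w → ¬ T (bit (slot s) (used s)) → T (bit w (used (suc s))) → T (bit w (used s)) ⊎ w ≡ slot s
    bit-used-suc s w new t with ∨-elim {bit w (used s)} (subst T (bit-insert (slot s) w (used s) new) t)
    ... | inj₁ old = inj₁ old
    ... | inj₂ w≡v = inj₂ (≡ᵇ⇒≡ w (slot s) w≡v)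

    module Step (s : ℕ) (inv : Invariant s) where
      open Invariant inv

      owner<top : owner s < top s
      owner<top = <-≤-trans (s≤s (m≤n⇒m≤1+n (owner-≤ s))) (layer-mono s {0} {h (suc s)} z≤n)

      owner-bound : ∀ {v} → T (e (owner s) v) → v < β (suc (suc s))
      owner-bound = β-bound (s≤s (m≤n⇒m≤1+n (owner-≤ s)))

      decide : ∀ v → T (free (used s) v) → T (test s (used s + 2 ^ v)) ⊎
               ∃[ X ] reach (β (top s)) (remove (free (used s)) v) (top s) X < weight (top s) (demand (suc s)) X
      decide v fv with T-split (test s (used s + 2 ^ v))
      ... | inj₁ t = inj₁ t
      ... | inj₂ f with all-counterexample (2 ^ top s) _ f
      ...   | X , _ , ¬hall = inj₂ ((λ x → bit x X) , (begin-strict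
        reach (β (top s)) (remove (free (used s)) v) (top s) (λ x → bit x X)
          ≤⟨ ∑-mono (β (top s)) (λ w _ → ⟦⟧-mono (still-free w)) ⟩
        reach (β (top s)) (free (used s + 2 ^ v)) (top s) (λ x → bit x X)
          <⟨ ≰⇒> (λ le → ¬hall (<⇒<ᵇ (s≤s le))) ⟩
        weight (top s) (demand (suc s)) (λ x → bit x X) ∎))
        where
        open ≤-Reasoning
        still-free : ∀ w → T (remove (free (used s)) v w ∧ nbr (top s) (λ x → bit x X) w) →
                     T (free (used s + 2 ^ v) w ∧ nbr (top s) (λ x → bit x X) w)
        still-free w t with ∧-elim {remove (free (used s)) v w} t
        ... | rw , nw with ∧-elim {free (used s) w} rw
        ...   | fw , w≢v = ∧-intro (not-intro ¬bit) nw
          where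
          ¬bit : ¬ T (bit w (used s + 2 ^ v))
          ¬bit b with ∨-elim {bit w (used s)} (subst T (bit-insert v w (used s) (not-elim fv)) b)
          ... | inj₁ old = not-elim fw old
          ... | inj₂ w≡v = not-elim w≢v w≡v

      -- `hall-step` is applied inside `top s` only, where a failed test supplies the critical set
      -- it asks for. Beyond `top s` Hall's condition is restored afterwards by `Extend.global`.
      slot-good : T (good s (used s) (slot s))
      slot-good with hall-step (top s) (β (top s)) (λ x<top → β-bound x<top) (free (used s))
                       (demand s) (demand (suc s)) (owner s) owner<top (demand-owner s) (demand-other s)
                       (hall (top s)) decide
      ... | v , eov , fv , tv = least-witness {i = v} (good s (used s)) (owner-bound eov)
                                  (∧-intro eov (∧-intro fv tv))

      slot-edge : T (e (owner s) (slot s))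
      slot-edge = proj₁ (∧-elim slot-good)

      slot-new : ¬ T (bit (slot s) (used s))
      slot-new = not-elim (proj₁ (∧-elim {free (used s) (slot s)} (proj₂ (∧-elim {e (owner s) (slot s)} slot-good))))

      bound-suc : ∀ {w} → T (bit w (used (suc s))) → w < β (suc (suc s))
      bound-suc {w} t with bit-used-suc s w slot-new t
      ... | inj₁ old  = <-≤-trans (bound old) (β-mono (n≤1+n (suc s)))
      ... | inj₂ refl = owner-bound slot-edge

      size-suc : ∀ W → count W (λ w → bit w (used (suc s))) ≤ suc s
      size-suc W = begin
        count W (λ w → bit w (used (suc s)))                ≤⟨ ∑-mono W (λ w _ → subst (λ b → ⟦ b ⟧ ≤ ⟦ bit w (used s) ⟧ + ⟦ w ≡ᵇ slot s ⟧) (sym (bit-insert (slot s) w (used s) slot-new)) (∨-≤ (bit w (used s)) (w ≡ᵇ slot s))) ⟩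
        ∑ W (λ w → ⟦ bit w (used s) ⟧ + ⟦ w ≡ᵇ slot s ⟧)    ≡⟨ ∑-+ W _ _ ⟩
        count W (λ w → bit w (used s)) + count W (_≡ᵇ slot s) ≤⟨ +-mono-≤ (size W) (count-singleton W (slot s)) ⟩
        s + 1                                               ≡⟨ +-comm s 1 ⟩
        suc s                                               ∎
        where
        open ≤-Reasoning
        ∨-≤ : ∀ a b → ⟦ a ∨ b ⟧ ≤ ⟦ a ⟧ + ⟦ b ⟧
        ∨-≤ true  b = s≤s z≤n
        ∨-≤ false b = ≤-refl

      invariant-suc : Invariant (suc s)
      invariant-suc = record
        { hall  = Extend.global s (used (suc s)) bound-suc size-suc
                    (test-complete s (used (suc s))
                      (proj₂ (∧-elim {free (used s) (slot s)} (proj₂ (∧-elim {e (owner s) (slot s)} slot-good)))))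
        ; bound = bound-suc
        ; size  = size-suc
        }

    invariant : ∀ s → Invariant s
    invariant zero    = invariant-zero
    invariant (suc s) = Step.invariant-suc s (invariant s)

    slot-edge : ∀ s → T (e (owner s) (slot s))
    slot-edge s = Step.slot-edge s (invariant s)

    slot-new : ∀ s → ¬ T (bit (slot s) (used s))
    slot-new s = Step.slot-new s (invariant s)

    slot-used : ∀ {s t} → s < t → T (bit (slot s) (used t))
    slot-used {s} {suc t} s<1+t =
      subst T (sym (bit-insert (slot t) (slot s) (used t) (slot-new t))) (case (≤-suc-split s<1+t))
      where
      case : s < t ⊎ s ≡ t → T (bit (slot s) (used t) ∨ (slot s ≡ᵇ slot t))
      case (inj₁ s<t)  = ∨-introˡ (slot-used s<t)
      case (inj₂ refl) = ∨-introʳ {bit (slot s) (used t)} (≡⇒≡ᵇ (slot s) (slot s) refl)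

    slot-injective : ∀ {s t} → slot s ≡ slot t → s ≡ t
    slot-injective {s} {t} eq with <-cmp s t
    ... | tri≈ _ s≡t _ = s≡t
    ... | tri< s<t _ _ = ⊥-elim (slot-new t (subst (λ v → T (bit v (used t))) eq (slot-used s<t)))
    ... | tri> _ _ t<s = ⊥-elim (slot-new s (subst (λ v → T (bit v (used s))) (sym eq) (slot-used t<s)))

    module _ (eᴿ : Decᴿ {2} (λ xs → e (lookup xs zero) (lookup xs (suc zero))))
             (nbᴿ : Recursive {1} (λ xs → nb (lookup xs zero)))
             (hᴿ : Recursive {1} (λ xs → h (lookup xs zero))) where

      βᴿ : {f : Vec ℕ n → ℕ} → Recursive f → Recursive (λ xs → β (f xs))
      βᴿ = comp₁ {f = λ xs → β (lookup xs zero)} (+ᴿ x₀ (∑ᴿ (comp₁ nbᴿ x₀) x₀))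

      topᴿ : {f : Vec ℕ n → ℕ} → Recursive f → Recursive (λ xs → top (f xs))
      topᴿ = comp₁ {f = λ xs → top (lookup xs zero)} (comp₂ layerᴿ (comp₁ hᴿ (sucᴿ′ x₀)) x₀)
        where
        layerᴿ : Recursive {2} (λ xs → layer (lookup xs (suc zero)) (lookup xs zero))
        layerᴿ = natrecᴿ (sucᴿ′ (sucᴿ′ x₀)) (βᴿ (βᴿ x₁)) (λ { (_ ∷ []) → refl }) (λ { _ (_ ∷ []) → refl })

      demandᴿ : {f g : Vec ℕ n → ℕ} → Recursive f → Recursive g → Recursive (λ xs → demand (f xs) (g xs))
      demandᴿ fᴿ gᴿ = ⊓ᴿ (∸ᴿ (*ᴿ (constᴿ d) (sucᴿ′ gᴿ)) fᴿ) (constᴿ d)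

      testᴿ : {f g : Vec ℕ n → ℕ} → Recursive f → Recursive g → Decᴿ (λ xs → test (f xs) (g xs))
      testᴿ = comp₂ {f = λ xs → ⟦ test (lookup xs zero) (lookup xs (suc zero)) ⟧}
        -- The variables are de Bruijn indices: every bounded operator pushes its bound variable in
        -- front of the parameters `s` and `B`.
        (allᴿ (<ᵇᴿ (∑ᴿ (*ᴿ (bitᴿ x₀ x₁) (demandᴿ (sucᴿ′ x₂) x₀)) (topᴿ x₁))
                   (sucᴿ′ (∑ᴿ (∧ᴿ (notᴿ (bitᴿ x₀ x₃)) (anyᴿ (∧ᴿ (bitᴿ x₀ x₂) (comp₂ eᴿ x₀ x₁)) (topᴿ x₂)))
                              (βᴿ (topᴿ x₁)))))
              (2^ᴿ (topᴿ x₀)))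

      ownerᴿ : {f : Vec ℕ n → ℕ} → Recursive f → Recursive (λ xs → owner (f xs))
      ownerᴿ = comp₁ {f = λ xs → owner (lookup xs zero)}
        (leastᴿ (<ᵇᴿ x₁ (*ᴿ (constᴿ d) (sucᴿ′ x₀))) (sucᴿ′ x₀))

      chooseᴿ : {f g : Vec ℕ n → ℕ} → Recursive f → Recursive g → Recursive (λ xs → choose (f xs) (g xs))
      chooseᴿ = comp₂ {f = λ xs → choose (lookup xs zero) (lookup xs (suc zero))}
        (leastᴿ (∧ᴿ (comp₂ eᴿ (ownerᴿ x₁) x₀)
                    (∧ᴿ (notᴿ (bitᴿ x₀ x₂)) (testᴿ x₁ (+ᴿ x₂ (2^ᴿ x₀)))))
                (βᴿ (sucᴿ′ (sucᴿ′ x₀))))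

      slotᴿ : {f : Vec ℕ n → ℕ} → Recursive f → Recursive (λ xs → slot (f xs))
      slotᴿ = comp₁ {f = λ xs → slot (lookup xs zero)} (chooseᴿ x₀ (comp₁ usedᴿ x₀))
        where
        usedᴿ : Recursive {1} (λ xs → used (lookup xs zero))
        usedᴿ = natrecᴿ (constᴿ 0) (+ᴿ x₁ (2^ᴿ (chooseᴿ x₀ x₁))) (λ { [] → refl }) (λ { _ [] → refl })

-- Orbits, dropped children and the exchange along rays

iter : (ℕ → ℕ) → ℕ → ℕ → ℕ
iter g x zero    = x
iter g x (suc i) = g (iter g x i)

iter-+ : ∀ g x i j → iter g x (i + j) ≡ iter g (iter g x i) j
iter-+ g x i zero    = cong (iter g x) (+-identityʳ i)
iter-+ g x i (suc j) = trans (cong (iter g x) (+-suc i j)) (cong g (iter-+ g x i j))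

-- The value 0 stands for a missing parent and absorbs orbits. Two distinct children of each vertex
-- suffice here: whichever child is dropped, one of the two can continue the ray.
module Pairing
  (P : ℕ → ℕ) (P-zero : P 0 ≡ 0)
  (kid₀ kid₁ : ℕ → ℕ)
  (P-kid₀ : ∀ {u} → 1 ≤ u → P (kid₀ u) ≡ u)
  (P-kid₁ : ∀ {u} → 1 ≤ u → P (kid₁ u) ≡ u)
  (kid₀≢kid₁ : ∀ {u} → 1 ≤ u → kid₀ u ≢ kid₁ u)
  where

  orb : ℕ → ℕ → ℕ
  orb = iter P

  -- Limiting the steps by `suc m` yields `steps-≤`, and through it the bound `n` on the period of a
  -- repetition.
  hits : ℕ → ℕ → Bool
  hits u m = anyBelow (suc m) (λ i → orb m (suc i) ≡ᵇ u)

  P≥1 : ∀ {x u} → 1 ≤ u → P x ≡ u → 1 ≤ x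
  P≥1 {zero}  1≤u Px≡u = contradiction (trans (sym P-zero) Px≡u) (<⇒≢ 1≤u)
  P≥1 {suc x} 1≤u Px≡u = s≤s z≤n

  orb-0 : ∀ i → orb 0 i ≡ 0
  orb-0 zero    = refl
  orb-0 (suc i) = trans (cong P (orb-0 i)) P-zero

  hits-intro : ∀ {u m i} → i ≤ m → orb m (suc i) ≡ u → T (hits u m)
  hits-intro {u} {m} {i} i≤m eq = any-intro _ (s≤s i≤m) (≡⇒≡ᵇ (orb m (suc i)) u eq)

  opaque

    -- The search cannot fail, since `kid₀ u` reaches `u` in one step.
    first : ℕ → ℕ
    first u = least (suc (kid₀ u)) (hits u)

    steps : ℕ → ℕ
    steps u = least (suc (first u)) (λ i → orb (first u) (suc i) ≡ᵇ u)

    first-≤ : ∀ {u m i} → i ≤ m → orb m (suc i) ≡ u → first u ≤ m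
    first-≤ {u} i≤m eq = least-≤-witness (suc (kid₀ u)) (hits u) (hits-intro i≤m eq)

    first-hits : ∀ {u} → 1 ≤ u → ∃[ i ] i < suc (first u) × orb (first u) (suc i) ≡ u
    first-hits {u} 1≤u =
      let i , i< , t = any-elim (suc (first u)) (λ i → orb (first u) (suc i) ≡ᵇ u)
                         (least-witness (hits u) (n<1+n (kid₀ u)) (hits-intro {u} {kid₀ u} {0} z≤n (P-kid₀ 1≤u)))
      in i , i< , ≡ᵇ⇒≡ (orb (first u) (suc i)) u t

    steps-minimal : ∀ {u i} → orb (first u) (suc i) ≡ u → steps u ≤ i
    steps-minimal {u} {i} eq = least-≤-witness (suc (first u)) (λ i → orb (first u) (suc i) ≡ᵇ u)
      (≡⇒≡ᵇ (orb (first u) (suc i)) u eq)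

    orb-steps : ∀ {u} → 1 ≤ u → orb (first u) (suc (steps u)) ≡ u
    orb-steps {u} 1≤u = let i , i< , t = first-hits 1≤u in
      ≡ᵇ⇒≡ _ u (least-witness (λ i → orb (first u) (suc i) ≡ᵇ u) i< (≡⇒≡ᵇ (orb (first u) (suc i)) u t))

  1≤first : ∀ {u} → 1 ≤ u → 1 ≤ first u
  1≤first {u} 1≤u with first u | first-hits 1≤u
  ... | suc m | _ = s≤s z≤n
  ... | zero  | i , _ , eq = contradiction (trans (sym (orb-0 (suc i))) eq) (<⇒≢ 1≤u)

  steps-≤ : ∀ {u} → 1 ≤ u → steps u ≤ first u
  steps-≤ 1≤u = let i , i< , eq = first-hits 1≤u in ≤-trans (steps-minimal eq) (≤-pred i<)

  -- The child of u through which the orbit of the first m reaching u within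
  -- suc m steps passes.
  drop : ℕ → ℕ
  drop u = orb (first u) (steps u)

  P-drop : ∀ {u} → 1 ≤ u → P (drop u) ≡ u
  P-drop = orb-steps

  isRoot : ℕ → Bool
  isRoot x = (P x ≡ᵇ 0) ∨ (drop (P x) ≡ᵇ x)

  opaque

    -- At least one of `kid₀ u` and `kid₁ u` is not dropped, and their sum bounds both.
    heir : ℕ → ℕ
    heir u = least (suc (kid₀ u + kid₁ u)) (λ x → (P x ≡ᵇ u) ∧ not (drop u ≡ᵇ x))

    heir-spec : ∀ {u} → 1 ≤ u → P (heir u) ≡ u × drop u ≢ heir u
    heir-spec {u} 1≤u = case (drop u ≟ kid₀ u)
      where
      Candidate : ℕ → Bool
      Candidate x = (P x ≡ᵇ u) ∧ not (drop u ≡ᵇ x)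
      found : ∀ {x} → x ≤ kid₀ u + kid₁ u → P x ≡ u → drop u ≢ x → P (heir u) ≡ u × drop u ≢ heir u
      found {x} x≤ Px≡u drop≢x =
        let t = least-witness Candidate (s≤s x≤) (∧-intro (≡⇒≡ᵇ (P x) u Px≡u) (not-intro (λ t → drop≢x (≡ᵇ⇒≡ (drop u) x t))))
            p , q = ∧-elim {P (heir u) ≡ᵇ u} t
        in ≡ᵇ⇒≡ (P (heir u)) u p , λ eq → not-elim q (≡⇒≡ᵇ (drop u) (heir u) eq)
      case : Dec (drop u ≡ kid₀ u) → P (heir u) ≡ u × drop u ≢ heir u
      case (no  drop≢kid₀) = found (m≤m+n (kid₀ u) (kid₁ u)) (P-kid₀ 1≤u) drop≢kid₀
      case (yes drop≡kid₀) = found (m≤n+m (kid₁ u) (kid₀ u)) (P-kid₁ 1≤u)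
                               (λ drop≡kid₁ → kid₀≢kid₁ 1≤u (trans (sym drop≡kid₀) drop≡kid₁))

  linked : ℕ → Bool
  linked x = not (isRoot x) ∧ (heir (P x) ≡ᵇ x)

  root-drop : ∀ {u} → 1 ≤ u → T (isRoot (drop u))
  root-drop {u} 1≤u = ∨-introʳ {P (drop u) ≡ᵇ 0} (≡⇒≡ᵇ _ _ (cong drop (P-drop 1≤u)))

  nonroot⇒1≤P : ∀ {x} → ¬ T (isRoot x) → 1 ≤ P x
  nonroot⇒1≤P {x} ¬r with P x
  ... | zero  = ⊥-elim (¬r tt)
  ... | suc _ = s≤s z≤n

  nonroot⇒≢drop : ∀ {x} → ¬ T (isRoot x) → drop (P x) ≢ x
  nonroot⇒≢drop {x} ¬r eq = ¬r (∨-introʳ {P x ≡ᵇ 0} (≡⇒≡ᵇ _ x eq))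

  nonroot-intro : ∀ {x u} → 1 ≤ u → P x ≡ u → drop u ≢ x → ¬ T (isRoot x)
  nonroot-intro {x} 1≤u refl ≢x r with ∨-elim {P x ≡ᵇ 0} r
  ... | inj₁ P≡0 = <⇒≢ 1≤u (sym (≡ᵇ⇒≡ (P x) 0 P≡0))
  ... | inj₂ eq  = ≢x (≡ᵇ⇒≡ _ x eq)

  -- If 1 has a parent, then 1 is the least positive number and reaches that parent in one step, so
  -- it is the child dropped there. As a root, 1 lies on a 2-cycle of `f`.
  root-1 : T (isRoot 1)
  root-1 with T-split (isRoot 1)
  ... | inj₁ r  = r
  ... | inj₂ ¬r = contradiction drop≡1 (nonroot⇒≢drop ¬r)
    where
    1≤P1 = nonroot⇒1≤P ¬r
    first≡1 : first (P 1) ≡ 1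
    first≡1 = ≤-antisym (first-≤ {P 1} {1} {0} z≤n refl) (1≤first 1≤P1)
    steps≡0 : steps (P 1) ≡ 0
    steps≡0 = n≤0⇒n≡0 (steps-minimal {P 1} {0} (cong P first≡1))
    drop≡1 : drop (P 1) ≡ 1
    drop≡1 = trans (cong (orb (first (P 1))) steps≡0) first≡1

  -- The orbit of n meets the n + 1 vertices orb n (suc i) for i ≤ n, for which
  -- first lies in 1, …, n.  If two of them have the same value m of first, the
  -- orbit of m passes through the dropped children of both.
  module _ (n : ℕ) (nonroot : ∀ {j} → j ≤ n + n → ¬ T (isRoot (orb n j))) where

    private
      v : ℕ → ℕ
      v = orb n

      1≤n : 1 ≤ n
      1≤n = P≥1 (nonroot⇒1≤P (nonroot {0} z≤n)) refl

      1≤v : ∀ {j} → j ≤ n + n → 1 ≤ v (suc j)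
      1≤v j≤ = nonroot⇒1≤P (nonroot j≤)

      first-v : ∀ {i} → i ≤ n → first (v (suc i)) ≤ n
      first-v i≤n = first-≤ i≤n refl

      record ChildAt (m a u w : ℕ) : Set where
        field
          child   : P w ≡ u
          reached : orb m a ≡ w

      -- One of the `suc t` steps leads from `w` to its parent `u`.
      later-child : ∀ {m a t u u′ w w′} → ChildAt m a u w → ChildAt m (a + suc t) u′ w′ → w′ ≡ orb u t
      later-child {m} {a} {t} {u} {w = w} {w′} d d′ = begin
        w′                  ≡⟨ sym (reached d′) ⟩
        orb m (a + suc t)   ≡⟨ iter-+ P m a (suc t) ⟩
        orb (orb m a) (suc t) ≡⟨ cong (λ z → orb z (suc t)) (reached d) ⟩
        orb w (suc t)       ≡⟨ iter-+ P w 1 t ⟩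
        orb (P w) t         ≡⟨ cong (λ z → orb z t) (child d) ⟩
        orb u t             ∎
        where
        open ≡-Reasoning
        open ChildAt

      Repetition : Set
      Repetition = ∃[ k ] ∃[ l ] 1 ≤ l × l ≤ n × k + l ≤ n + n × v (k + l) ≡ v k

      repetition : ∀ {k k′} → k < k′ → k′ ≤ k + n → k′ ≤ n + n → v k ≡ v k′ → Repetition
      repetition {k} {k′} k<k′ k′≤k+n k′≤2n eq =
        k , k′ ∸ k , m<n⇒0<n∸m k<k′ , m≤n+o⇒m∸n≤o k′ k k′≤k+n ,
        subst (_≤ n + n) (sym k+) k′≤2n , trans (cong v k+) (sym eq)
        where
        k+ : k + (k′ ∸ k) ≡ k′
        k+ = m+[n∸m]≡n (<⇒≤ k<k′)

      1+n≤2n : suc n ≤ n + n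
      1+n≤2n = +-monoˡ-≤ n 1≤n

      -- Let the orbit of the common `m` be at the dropped children of `v (suc i)` and `v (suc j)`
      -- after `a` and `b` steps. If `a ≡ b`, the children coincide and so do the parents. If
      -- `a < b`, the child of `v (suc j)` occurs at index `suc i + t`, so `v (suc j)` recurs one
      -- step later; equal indices would make `v j` a dropped child. If `b < a`, the child of
      -- `v (suc i)`, a root, occurs at index `suc j + t ≤ n + n`, which is excluded; hence the
      -- bound `2n`.
      same-first⇒repetition : ∀ i j → i < j → j ≤ n → first (v (suc i)) ≡ first (v (suc j)) → Repetition
      same-first⇒repetition i j i<j j≤n same with <-cmp (steps (v (suc i))) (steps (v (suc j)))
      ... | tri≈ _ a≡b _ = repetition (s≤s i<j) (s≤s (≤-trans j≤n (m≤n+m n i))) (≤-trans (s≤s j≤n) 1+n≤2n)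
        (trans (sym (P-drop (1≤v i≤2n))) (trans (cong P (cong₂ orb same a≡b)) (P-drop (1≤v j≤2n))))
        where
        j≤2n = ≤-trans j≤n (m≤m+n n n)
        i≤2n = ≤-trans (<⇒≤ i<j) j≤2n
      ... | tri< a<b _ _ = closes (<-cmp (suc j) (suc (suc i + t)))
        where
        a = steps (v (suc i))
        b = steps (v (suc j))
        j≤2n = ≤-trans j≤n (m≤m+n n n)
        i≤2n = ≤-trans (<⇒≤ i<j) j≤2n
        t = b ∸ suc a
        b≡ : a + suc t ≡ b
        b≡ = trans (+-suc a t) (m+[n∸m]≡n a<b)
        1+t≤n : suc t ≤ n
        1+t≤n = ≤-trans (m≤n+m (suc t) a) (≤-trans (≤-reflexive b≡) (≤-trans (steps-≤ (1≤v j≤2n)) (first-v j≤n)))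
        w≡ : drop (v (suc j)) ≡ v (suc i + t)
        w≡ = trans (later-child {m = first (v (suc i))} {a}
               (record { child = P-drop (1≤v i≤2n) ; reached = refl })
               (record { child = P-drop (1≤v j≤2n) ; reached = cong₂ orb same b≡ }))
             (sym (iter-+ P n (suc i) t))
        v≡ : v (suc j) ≡ v (suc (suc i + t))
        v≡ = trans (sym (P-drop (1≤v j≤2n))) (cong P w≡)
        bound : suc (suc i + t) ≤ suc i + n
        bound = ≤-trans (≤-reflexive (sym (+-suc (suc i) t))) (+-monoʳ-≤ (suc i) 1+t≤n)
        closes : _ → Repetition
        closes (tri≈ _ j≡ _) = contradiction
          (trans w≡ (cong v (sym (suc-injective j≡)))) (nonroot⇒≢drop (nonroot j≤2n))
        closes (tri< lt _ _) = repetition lt (≤-trans bound (+-monoˡ-≤ n (m≤n⇒m≤1+n i<j)))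
          (≤-trans bound (+-monoˡ-≤ n (≤-trans i<j j≤n))) v≡
        closes (tri> _ _ gt) = repetition gt (s≤s (≤-trans j≤n (m≤n+m n (suc i + t)))) (≤-trans (s≤s j≤n) 1+n≤2n) (sym v≡)
      ... | tri> _ _ b<a = ⊥-elim (nonroot index≤ (subst (T ∘ isRoot) w≡ (root-drop (1≤v i≤2n))))
        where
        a = steps (v (suc i))
        b = steps (v (suc j))
        j≤2n = ≤-trans j≤n (m≤m+n n n)
        i≤2n = ≤-trans (<⇒≤ i<j) j≤2n
        t = a ∸ suc b
        a≡ : b + suc t ≡ a
        a≡ = trans (+-suc b t) (m+[n∸m]≡n b<a)
        1+t≤n : suc t ≤ n
        1+t≤n = ≤-trans (m≤n+m (suc t) b) (≤-trans (≤-reflexive a≡)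
          (≤-trans (steps-≤ (1≤v i≤2n)) (first-v (≤-trans (<⇒≤ i<j) j≤n))))
        w≡ : drop (v (suc i)) ≡ v (suc j + t)
        w≡ = trans (later-child {m = first (v (suc j))} {b}
               (record { child = P-drop (1≤v j≤2n) ; reached = refl })
               (record { child = P-drop (1≤v i≤2n) ; reached = cong₂ orb (sym same) a≡ }))
             (sym (iter-+ P n (suc j) t))
        index≤ : suc j + t ≤ n + n
        index≤ = ≤-trans (≤-reflexive (sym (+-suc j t))) (+-mono-≤ j≤n 1+t≤n)

    rootless⇒repetition : ∃[ k ] ∃[ l ] 1 ≤ l × l ≤ n × k + l ≤ n + n × orb n (k + l) ≡ orb n k
    rootless⇒repetition with pigeonhole (n<1+n n) (λ i → fromℕ< (pred-first< i))
      where
      pred-first< : ∀ (i : Fin (suc n)) → pred (first (v (suc (toℕ i)))) < n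
      pred-first< i with first (v (suc (toℕ i))) | first-v (≤-pred (toℕ<n i))
                       | 1≤first (1≤v (≤-trans (≤-pred (toℕ<n i)) (m≤m+n n n)))
      ... | suc m | m<n | _ = m<n
    ... | i , j , i<j , eq = same-first⇒repetition (toℕ i) (toℕ j) i<j (≤-pred (toℕ<n j))
      (pred-injective′ (1≤f i) (1≤f j) (fromℕ<-injective _ _ _ _ eq))
      where
      1≤f : ∀ (i : Fin (suc n)) → 1 ≤ first (v (suc (toℕ i)))
      1≤f i = 1≤first (1≤v (≤-trans (≤-pred (toℕ<n i)) (m≤m+n n n)))
      pred-injective′ : ∀ {a b} → 1 ≤ a → 1 ≤ b → pred a ≡ pred b → a ≡ b
      pred-injective′ (s≤s _) (s≤s _) = cong suc

    private
      -- An index beyond `n + n` is lowered by the period `l`; as `1 ≤ l`, this descent is measured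
      -- by `fuel`.
      periodic-nonroot : ∀ {k l} → 1 ≤ l → k + l ≤ n + n → orb n (k + l) ≡ orb n k →
                         ∀ fuel j → j ≤ fuel → ¬ T (isRoot (orb n j))
      periodic-nonroot {k} {l} 1≤l k+l≤2n eq = go
        where
        go : ∀ fuel j → j ≤ fuel → ¬ T (isRoot (orb n j))
        go fuel j j≤ with <-≤-connex (n + n) j
        ... | inj₂ j≤2n = nonroot j≤2n
        go zero    .0 z≤n | inj₁ ()
        go (suc fuel) j j≤ | inj₁ 2n<j = subst (λ z → ¬ T (isRoot z)) shift (go fuel (k + r) k+r≤)
          where
          r = j ∸ (k + l)
          j≡ : k + l + r ≡ j
          j≡ = m+[n∸m]≡n (≤-trans k+l≤2n (<⇒≤ 2n<j))
          k+r≤ : k + r ≤ fuel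
          k+r≤ = ≤-pred (≤-trans (+-monoˡ-≤ r (≤-trans (≤-reflexive (+-comm 1 k)) (+-monoʳ-≤ k 1≤l)))
                   (≤-trans (≤-reflexive j≡) j≤))
          shift : orb n (k + r) ≡ orb n j
          shift = begin
            orb n (k + r)         ≡⟨ iter-+ P n k r ⟩
            orb (orb n k) r       ≡⟨ cong (λ z → orb z r) (sym eq) ⟩
            orb (orb n (k + l)) r ≡⟨ sym (iter-+ P n (k + l) r) ⟩
            orb n (k + l + r)     ≡⟨ cong (orb n) j≡ ⟩
            orb n j               ∎
            where open ≡-Reasoning

    -- The orbit repeats within its first `n + n` steps and shows no new vertex later. This makes
    -- the search for a root ahead of `n` a bounded one.
    never-root : ∀ j → ¬ T (isRoot (orb n j))
    never-root j with rootless⇒repetition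
    ... | _ , _ , 1≤l , _ , k+l≤2n , eq = periodic-nonroot 1≤l k+l≤2n eq j j ≤-refl

  -- Rays and parity

  linked⇒nonroot : ∀ {x} → T (linked x) → ¬ T (isRoot x)
  linked⇒nonroot {x} l = not-elim (proj₁ (∧-elim {not (isRoot x)} l))

  linked⇒heir : ∀ {x} → T (linked x) → heir (P x) ≡ x
  linked⇒heir {x} l = ≡ᵇ⇒≡ (heir (P x)) x (proj₂ (∧-elim {not (isRoot x)} l))

  linked⇒1≤P : ∀ {x} → T (linked x) → 1 ≤ P x
  linked⇒1≤P l = nonroot⇒1≤P (linked⇒nonroot l)

  linked-intro : ∀ {x} → ¬ T (isRoot x) → heir (P x) ≡ x → T (linked x)
  linked-intro {x} ¬r eq = ∧-intro (not-intro ¬r) (≡⇒≡ᵇ (heir (P x)) x eq)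

  linked-heir : ∀ {u} → 1 ≤ u → T (linked (heir u))
  linked-heir {u} 1≤u = let P≡ , ≢drop = heir-spec 1≤u in
    linked-intro (nonroot-intro 1≤u P≡ ≢drop) (cong heir P≡)

  -- On the ray r₀, r₁ = heir r₀, r₂ = heir r₁, … below a root r₀ the vertices
  -- r₂ᵢ and r₂ᵢ₊₁ are exchanged; the even vertices are the r₂ᵢ.
  data Even (x : ℕ) : Set where
    root : T (isRoot x) → Even x
    step : T (linked x) → T (linked (P x)) → Even (P (P x)) → Even x

  -- The two vertices climb the ray alternately until one of them would be both a root and linked.
  not-both-even : ∀ {x} → T (linked x) → Even x → Even (P x) → ⊥
  not-both-even l (root r)      _  = linked⇒nonroot l r
  not-both-even l (step _ l′ e) e′ = not-both-even l′ e′ e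

  record RayLength (x j : ℕ) : Set where
    field
      end  : T (isRoot (orb x j))
      links : ∀ {t} → t < j → T (linked (orb x t))

  open RayLength

  -- Linked vertices are not roots, so a longer ray would satisfy the hypothesis of `never-root` and
  -- yet end in a root.
  ray-length-≤ : ∀ {x j} → RayLength x j → j ≤ x + x
  ray-length-≤ {x} {j} ray with <-≤-connex (x + x) j
  ... | inj₂ j≤ = j≤
  ... | inj₁ <j = ⊥-elim (never-root x (λ t≤ → linked⇒nonroot (links ray (≤-<-trans t≤ <j))) j (end ray))

  Even⇒ray : ∀ {x} → Even x → ∃[ i ] RayLength x (i + i)
  Even⇒ray (root r) = 0 , record { end = r ; links = λ () }
  Even⇒ray {x} (step l l′ e) with Even⇒ray e
  ... | i , ray = suc i , subst (RayLength x) (cong suc (sym (+-suc i i))) (record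
    { end   = subst (T ∘ isRoot) (sym (iter-+ P x 2 (i + i))) (end ray)
    ; links = λ { {zero} _ → l ; {suc zero} _ → l′
                ; {suc (suc t)} t< → subst (T ∘ linked) (sym (iter-+ P x 2 t)) (links ray (≤-pred (≤-pred t<))) } })

  ray⇒Even : ∀ i {x} → RayLength x (i + i) → Even x
  ray⇒Even zero    ray = root (end ray)
  ray⇒Even (suc i) {x} ray₀ = step (links ray (s≤s z≤n)) (links ray (s≤s (s≤s z≤n))) (ray⇒Even i (record
    { end   = subst (T ∘ isRoot) (iter-+ P x 2 (i + i)) (end ray)
    ; links = λ {t} t< → subst (T ∘ linked) (iter-+ P x 2 t) (links ray (s≤s (s≤s t<))) }))
    where
    ray : RayLength x (suc (suc (i + i)))
    ray = subst (RayLength x) (cong suc (+-suc i i)) ray₀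

  isRay : ℕ → ℕ → Bool
  isRay x i = isRoot (orb x (i + i)) ∧ allBelow (i + i) (λ t → linked (orb x t))

  opaque

    -- The distance `i + i` to the root is at most `x + x`, so `i ≤ x` covers all cases and the
    -- inductive `Even` becomes decidable.
    even : ℕ → Bool
    even x = anyBelow (suc x) (isRay x)

    even-sound : ∀ {x} → T (even x) → Even x
    even-sound {x} t =
      let i , _ , t′ = any-elim (suc x) (isRay x) t ; r , ls = ∧-elim {isRoot (orb x (i + i))} t′
      in ray⇒Even i (record { end = r ; links = λ t< → all-elim (λ t → linked (orb x t)) ls t< })

    even-complete : ∀ {x} → Even x → T (even x)
    even-complete {x} e =
      let i , ray = Even⇒ray e
          i≤x = ≮⇒≥ (λ x<i → <⇒≱ (+-mono-< x<i x<i) (ray-length-≤ ray))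
      in any-intro {suc x} {i} (isRay x) (s≤s i≤x)
           (∧-intro {isRoot (orb x (i + i))} (end ray)
             (all-intro (i + i) (λ t → linked (orb x t)) (λ t t< → links ray t<)))

  f : ℕ → ℕ
  f x = if even x then heir x else P x

  Even? : ∀ x → Even x ⊎ ¬ Even x
  Even? x with T-split (even x)
  ... | inj₁ t = inj₁ (even-sound t)
  ... | inj₂ ¬t = inj₂ (¬t ∘ even-complete)

  f-even : ∀ {x} → Even x → f x ≡ heir x
  f-even {x} e with even x | even-complete e
  ... | true | _ = refl

  f-other : ∀ {x} → ¬ Even x → f x ≡ P x
  f-other {x} ¬e with even x | even-sound {x}
  ... | true  | sound = ⊥-elim (¬e (sound tt))
  ... | false | _     = refl

  ¬Even⇒1≤P : ∀ {x} → ¬ Even x → 1 ≤ P x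
  ¬Even⇒1≤P ¬e = nonroot⇒1≤P (¬e ∘ root)

  f-positive : ∀ {x} → 1 ≤ x → 1 ≤ f x
  f-positive {x} 1≤x with Even? x
  ... | inj₁ e  = subst (1 ≤_) (sym (f-even e)) (P≥1 1≤x (proj₁ (heir-spec 1≤x)))
  ... | inj₂ ¬e = subst (1 ≤_) (sym (f-other ¬e)) (¬Even⇒1≤P ¬e)

  f-edge : ∀ {x} → 1 ≤ x → P (f x) ≡ x ⊎ P x ≡ f x
  f-edge {x} 1≤x with Even? x
  ... | inj₁ e  = inj₁ (trans (cong P (f-even e)) (proj₁ (heir-spec 1≤x)))
  ... | inj₂ ¬e = inj₂ (sym (f-other ¬e))

  heir-not-even : ∀ {x} → 1 ≤ x → Even x → ¬ Even (heir x)
  heir-not-even 1≤x e e′ = not-both-even (linked-heir 1≤x) e′ (subst Even (sym (proj₁ (heir-spec 1≤x))) e)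

  f-involutive : ∀ {x} → 1 ≤ x → Even x → f (f x) ≡ x
  f-involutive {x} 1≤x e = begin
    f (f x)    ≡⟨ cong f (f-even e) ⟩
    f (heir x) ≡⟨ f-other (heir-not-even 1≤x e) ⟩
    P (heir x) ≡⟨ proj₁ (heir-spec 1≤x) ⟩
    x          ∎
    where open ≡-Reasoning

  f-involutive-1 : f (f 1) ≡ 1
  f-involutive-1 = f-involutive ≤-refl (root root-1)

  -- The orbit under `f` follows `P` until it meets an even vertex, at the latest the root, and
  -- there `f` is an involution.
  reaches-2-cycle : ∀ j {x} → 1 ≤ x → T (isRoot (orb x j)) → ∃[ k ] k ≤ j × iter f x (k + 2) ≡ iter f x k
  reaches-2-cycle j {x} 1≤x r with Even? x
  ... | inj₁ e = 0 , z≤n , f-involutive 1≤x e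
  reaches-2-cycle zero    1≤x r | inj₂ ¬e = ⊥-elim (¬e (root r))
  reaches-2-cycle (suc j) {x} 1≤x r | inj₂ ¬e =
    let k , k≤j , eq = reaches-2-cycle j (¬Even⇒1≤P ¬e) (subst (T ∘ isRoot) (iter-+ P x 1 j) r)
    in suc k , s≤s k≤j , trans (shift (k + 2)) (trans eq (sym (shift k)))
    where
    shift : ∀ i → iter f x (suc i) ≡ iter f (P x) i
    shift i = trans (iter-+ f x 1 i) (cong (λ z → iter f z i) (f-other ¬e))

  Eventually-periodic : ℕ → Set
  Eventually-periodic x = ∃[ k ] ∃[ l ] k ≤ 2 * x × 1 ≤ l × l ≤ x × iter f x (k + l) ≡ iter f x k

  eventually-periodic : ∀ x → 2 ≤ x → Eventually-periodic x
  eventually-periodic x 2≤x with T-split (anyBelow (suc (x + x)) (λ j → isRoot (orb x j)))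
  ... | inj₁ some =
    let j , j< , r = any-elim (suc (x + x)) _ some
        k , k≤j , eq = reaches-2-cycle j (≤-trans (s≤s z≤n) 2≤x) r
    -- The period 2 is admissible exactly because `2 ≤ x`.
    in k , 2 , subst (k ≤_) (cong (x +_) (sym (+-identityʳ x))) (≤-trans k≤j (≤-pred j<)) , s≤s z≤n , 2≤x , eq
  ... | inj₂ none =
    let k , l , 1≤l , l≤x , k+l≤ , eq = rootless⇒repetition x nonroot
    in k , l , subst (k ≤_) (cong (x +_) (sym (+-identityʳ x))) (≤-trans (m≤m+n k l) k+l≤) , 1≤l , l≤x ,
       trans (f≡P (k + l)) (trans eq (sym (f≡P k)))
    where
    nonroot : ∀ {j} → j ≤ x + x → ¬ T (isRoot (orb x j))
    nonroot j≤ r = none (any-intro _ (s≤s j≤) r)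
    -- An even vertex has a root ahead of it, so `f` and `P` agree on a rootless orbit.
    ¬Even : ∀ j → ¬ Even (orb x j)
    ¬Even j e with Even⇒ray e
    ... | i , ray = never-root x nonroot (j + (i + i)) (subst (T ∘ isRoot) (sym (iter-+ P x j (i + i))) (end ray))
    f≡P : ∀ j → iter f x j ≡ orb x j
    f≡P zero    = refl
    f≡P (suc j) = trans (cong f (f≡P j)) (f-other (¬Even j))

  -- Preimages under the exchanged map

  Paired : ℕ → Set
  Paired u = T (linked u) × Even (P u)

  -- Paired vertices are the odd ones of the rays. Such a `u` gains the preimage `P u` and loses
  -- `heir u`; for every other `u` the preimages are the children that were not dropped.
  Paired? : ∀ u → Paired u ⊎ ¬ Paired u
  Paired? u with T-split (linked u) | Even? (P u)
  ... | inj₁ l  | inj₁ e  = inj₁ (l , e)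
  ... | inj₂ ¬l | _       = inj₂ (¬l ∘ proj₁)
  ... | _       | inj₂ ¬e = inj₂ (¬e ∘ proj₂)

  kept-child-even : ∀ {x u} → 1 ≤ u → P x ≡ u → x ≢ drop u → Even x → Paired u × x ≡ heir u
  kept-child-even 1≤u refl x≢drop (root r)      = ⊥-elim (nonroot-intro 1≤u refl (x≢drop ∘ sym) r)
  kept-child-even 1≤u refl x≢drop (step l l′ e) = (l′ , e) , sym (linked⇒heir l)

  unpaired-preimage : ∀ {x u} → 1 ≤ x → 1 ≤ u → ¬ Paired u → f x ≡ u → P x ≡ u × x ≢ drop u
  unpaired-preimage {x} {u} 1≤x 1≤u ¬p fx≡u with Even? x
  ... | inj₂ ¬e = trans (sym (f-other ¬e)) fx≡u , λ { refl → ¬e (root (root-drop 1≤u)) }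
  ... | inj₁ e = ⊥-elim (¬p (subst Paired (trans (sym (f-even e)) fx≡u)
                   (linked-heir 1≤x , subst Even (sym (proj₁ (heir-spec 1≤x))) e)))

  unpaired-image : ∀ {x u} → 1 ≤ u → ¬ Paired u → P x ≡ u → x ≢ drop u → f x ≡ u
  unpaired-image 1≤u ¬p Px≡u x≢drop = trans (f-other (¬p ∘ proj₁ ∘ kept-child-even 1≤u Px≡u x≢drop)) Px≡u

  paired-preimage : ∀ {x u} → 1 ≤ x → 1 ≤ u → Paired u → f x ≡ u →
                    x ≡ P u ⊎ (P x ≡ u × x ≢ drop u × x ≢ heir u)
  paired-preimage {x} {u} 1≤x 1≤u (l , e) fx≡u with Even? x
  ... | inj₁ ex = inj₁ (sym (trans (cong P (trans (sym fx≡u) (f-even ex))) (proj₁ (heir-spec 1≤x))))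
  ... | inj₂ ¬e = inj₂ (trans (sym (f-other ¬e)) fx≡u , (λ { refl → ¬e (root (root-drop 1≤u)) }) ,
                        λ { refl → ¬e (step (linked-heir 1≤u) (subst (T ∘ linked) (sym P≡) l)
                                            (subst (Even ∘ P) (sym P≡) e)) })
    where P≡ = proj₁ (heir-spec 1≤u)

  paired-image-P : ∀ {u} → Paired u → f (P u) ≡ u
  paired-image-P (l , e) = trans (f-even e) (linked⇒heir l)

  paired-image : ∀ {x u} → 1 ≤ u → P x ≡ u → x ≢ drop u → x ≢ heir u → f x ≡ u
  paired-image 1≤u Px≡u x≢drop x≢heir = trans (f-other (x≢heir ∘ proj₂ ∘ kept-child-even 1≤u Px≡u x≢drop)) Px≡u

  -- Guards against counting `P u` twice when it is itself a child of `u`: being even, it is then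
  -- the dropped child or the heir, neither of which remains among the other preimages.
  paired-P-excluded : ∀ {u} → 1 ≤ u → Paired u → P (P u) ≡ u → P u ≢ drop u → P u ≡ heir u
  paired-P-excluded 1≤u (_ , e) PPu≡u Pu≢drop = proj₂ (kept-child-even 1≤u PPu≡u Pu≢drop e)

  module _ (Pᴿ : Recursive {1} (λ xs → P (lookup xs zero)))
           (kid₀ᴿ : Recursive {1} (λ xs → kid₀ (lookup xs zero)))
           (kid₁ᴿ : Recursive {1} (λ xs → kid₁ (lookup xs zero))) where

    orbᴿ : {g h : Vec ℕ n → ℕ} → Recursive g → Recursive h → Recursive (λ xs → orb (g xs) (h xs))
    orbᴿ gᴿ hᴿ = comp₂ {f = λ xs → orb (lookup xs (suc zero)) (lookup xs zero)}
      (natrecᴿ x₀ (comp₁ Pᴿ x₁) (λ { (_ ∷ []) → refl }) (λ { _ (_ ∷ []) → refl })) hᴿ gᴿ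

    opaque
      unfolding first

      firstᴿ : {g : Vec ℕ n → ℕ} → Recursive g → Recursive (λ xs → first (g xs))
      firstᴿ = comp₁ {f = λ xs → first (lookup xs zero)}
        (leastᴿ (anyᴿ (≡ᵇᴿ (orbᴿ x₁ (sucᴿ′ x₀)) x₂) (sucᴿ′ x₀)) (sucᴿ′ (comp₁ kid₀ᴿ x₀)))

      stepsᴿ : {g : Vec ℕ n → ℕ} → Recursive g → Recursive (λ xs → steps (g xs))
      stepsᴿ = comp₁ {f = λ xs → steps (lookup xs zero)}
        (leastᴿ (≡ᵇᴿ (orbᴿ (firstᴿ x₁) (sucᴿ′ x₀)) x₁) (sucᴿ′ (firstᴿ x₀)))

    dropᴿ : {g : Vec ℕ n → ℕ} → Recursive g → Recursive (λ xs → drop (g xs))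
    dropᴿ gᴿ = orbᴿ (firstᴿ gᴿ) (stepsᴿ gᴿ)

    isRootᴿ : {g : Vec ℕ n → ℕ} → Recursive g → Decᴿ (λ xs → isRoot (g xs))
    isRootᴿ gᴿ = ∨ᴿ (≡ᵇᴿ (comp₁ Pᴿ gᴿ) (constᴿ 0)) (≡ᵇᴿ (dropᴿ (comp₁ Pᴿ gᴿ)) gᴿ)

    opaque
      unfolding heir

      heirᴿ : {g : Vec ℕ n → ℕ} → Recursive g → Recursive (λ xs → heir (g xs))
      heirᴿ = comp₁ {f = λ xs → heir (lookup xs zero)}
        (leastᴿ (∧ᴿ (≡ᵇᴿ (comp₁ Pᴿ x₀) x₁) (notᴿ (≡ᵇᴿ (dropᴿ x₁) x₀)))
                (sucᴿ′ (+ᴿ (comp₁ kid₀ᴿ x₀) (comp₁ kid₁ᴿ x₀))))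

    linkedᴿ : {g : Vec ℕ n → ℕ} → Recursive g → Decᴿ (λ xs → linked (g xs))
    linkedᴿ gᴿ = ∧ᴿ (notᴿ (isRootᴿ gᴿ)) (≡ᵇᴿ (heirᴿ (comp₁ Pᴿ gᴿ)) gᴿ)

    opaque
      unfolding even

      evenᴿ : {g : Vec ℕ n → ℕ} → Recursive g → Decᴿ (λ xs → even (g xs))
      evenᴿ = comp₁ {f = λ xs → ⟦ even (lookup xs zero) ⟧}
        (anyᴿ (∧ᴿ (isRootᴿ (orbᴿ x₁ (+ᴿ x₀ x₀))) (allᴿ (linkedᴿ (orbᴿ x₂ x₀)) (+ᴿ x₀ x₀))) (sucᴿ′ x₀))

    fᴿ : {g : Vec ℕ n → ℕ} → Recursive g → Recursive (λ xs → f (g xs))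
    fᴿ gᴿ = ifᴿ (evenᴿ gᴿ) (heirᴿ gᴿ) (comp₁ Pᴿ gᴿ)

-- Inverting the choice of children

module Parents
  (d : ℕ) (slot : ℕ → ℕ) (slot-injective : ∀ {s t} → slot s ≡ slot t → s ≡ t)
  (β : ℕ → ℕ) (slot-bound : ∀ u i → i < d → u < β (suc (slot (d * u + i))))
  where

  -- Vertices are shifted: slot deals with x ∈ ℕ where kid and parent deal
  -- with suc x, and parent x = 0 when x has no parent.
  kid : ℕ → ℕ → ℕ
  kid u i = suc (slot (d * pred u + i))

  isKid : ℕ → ℕ → Bool
  isKid x u = anyBelow d (λ i → kid (suc u) i ≡ᵇ x)

  -- The range of a computable injection need not be decidable. Here a parent is a neighbour of its
  -- child, so `β` bounds the search.
  candidate : ℕ → ℕ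
  candidate x = least (β x) (isKid x)

  block-< : ∀ {u v i j} → u < v → i < d → d * u + i < d * v + j
  block-< {u} {v} {i} {j} u<v i<d = begin-strict
    d * u + i   <⟨ +-monoʳ-< (d * u) i<d ⟩
    d * u + d   ≡⟨ trans (+-comm (d * u) d) (sym (*-suc d u)) ⟩
    d * suc u   ≤⟨ *-monoʳ-≤ d u<v ⟩
    d * v       ≤⟨ m≤m+n (d * v) j ⟩
    d * v + j   ∎
    where open ≤-Reasoning

  block-unique : ∀ {u v i j} → i < d → j < d → d * u + i ≡ d * v + j → u ≡ v
  block-unique {u} {v} i<d j<d eq with <-cmp u v
  ... | tri≈ _ u≡v _ = u≡v
  ... | tri< u<v _ _ = contradiction eq (<⇒≢ (block-< u<v i<d))
  ... | tri> _ _ v<u = contradiction (sym eq) (<⇒≢ (block-< v<u j<d))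

  isKid-elim : ∀ x u → T (isKid x u) → ∃[ i ] i < d × kid (suc u) i ≡ x
  isKid-elim x u t = let i , i<d , eq = any-elim d (λ i → kid (suc u) i ≡ᵇ x) t in i , i<d , ≡ᵇ⇒≡ (kid (suc u) i) x eq

  isKid-kid : ∀ u {i} → i < d → T (isKid (kid (suc u) i) u)
  isKid-kid u {i} i<d = any-intro _ i<d (≡⇒≡ᵇ (kid (suc u) i) (kid (suc u) i) refl)

  kid-injective : ∀ u {i j} → kid u i ≡ kid u j → i ≡ j
  kid-injective u eq = +-cancelˡ-≡ (d * pred u) _ _ (slot-injective (suc-injective eq))

  opaque

    parent : ℕ → ℕ
    parent x = if isKid x (candidate x) then suc (candidate x) else 0

    parent-kid : ∀ {u i} → 1 ≤ u → i < d → parent (kid u i) ≡ u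
    parent-kid {suc u} {i} 1≤u i<d = found (isKid-elim x (candidate x) isKid-candidate)
      where
      x : ℕ
      x = kid (suc u) i
      isKid-candidate : T (isKid x (candidate x))
      isKid-candidate = least-witness (isKid x) (slot-bound u i i<d) (isKid-kid u i<d)
      found : ∃[ j ] j < d × kid (suc (candidate x)) j ≡ x → parent x ≡ suc u
      found (j , j<d , eq) with isKid x (candidate x) | isKid-candidate
      ... | true | _ = cong suc (block-unique j<d i<d (slot-injective (suc-injective eq)))

    parent-elim : ∀ {x u} → 1 ≤ u → parent x ≡ u → ∃[ i ] i < d × kid u i ≡ x
    parent-elim {x} 1≤u refl with isKid x (candidate x) | isKid-elim x (candidate x)
    parent-elim 1≤u refl | true  | elim = elim tt
    parent-elim ()  refl | false | _

    parent-zero : parent 0 ≡ 0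
    parent-zero with isKid 0 (candidate 0) | isKid-elim 0 (candidate 0)
    ... | false | _ = refl
    ... | true  | elim with elim tt
    ...   | _ , _ , ()

  module _ (slotᴿ : Recursive {1} (λ xs → slot (lookup xs zero))) where

    kidᴿ : {f g : Vec ℕ n → ℕ} → Recursive f → Recursive g → Recursive (λ xs → kid (f xs) (g xs))
    kidᴿ fᴿ gᴿ = sucᴿ′ (comp₁ slotᴿ (+ᴿ (*ᴿ (constᴿ d) (predᴿ fᴿ)) gᴿ))

    isKidᴿ : {f g : Vec ℕ n → ℕ} → Recursive f → Recursive g → Decᴿ (λ xs → isKid (f xs) (g xs))
    isKidᴿ = comp₂ {f = λ xs → ⟦ isKid (lookup xs zero) (lookup xs (suc zero)) ⟧}
      (anyᴿ (≡ᵇᴿ (kidᴿ (sucᴿ′ x₂) x₀) x₁) (constᴿ d))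

    opaque
      unfolding parent

      parentᴿ : Recursive {1} (λ xs → β (lookup xs zero)) → Recursive {1} (λ xs → parent (lookup xs zero))
      parentᴿ βᴿ = ifᴿ (isKidᴿ x₀ candidateᴿ) (sucᴿ′ candidateᴿ) (constᴿ 0)
        where
        candidateᴿ : Recursive {1} (λ xs → candidate (lookup xs zero))
        candidateᴿ = leastᴿ (isKidᴿ x₁ x₀) (comp₁ βᴿ x₀)

-- Finite sets of positive numbers

open _HasSize_

suc⁺ : ℕ → ℕ⁺
suc⁺ n = suc n , [ _ ]

pred⁺ : ℕ⁺ → ℕ
pred⁺ x = pred (value x)

value-positive : (x : ℕ⁺) → 1 ≤ value x
value-positive (zero  , [ p ]) = ⊥-elim-irr (NonZero.nonZero {0} p)
value-positive (suc n , _)     = s≤s z≤n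

suc-pred⁺ : ∀ (x : ℕ⁺) → suc (pred⁺ x) ≡ value x
suc-pred⁺ x with value x | value-positive x
... | suc n | _ = refl

suc⁺-pred⁺ : ∀ (x : ℕ⁺) → suc⁺ (pred⁺ x) ≡ x
suc⁺-pred⁺ x = value-injective (suc-pred⁺ x)

fromPositive : ∀ n → 1 ≤ n → ℕ⁺
fromPositive n 1≤n = n , [ >-nonZero 1≤n ]

_≟⁺_ : (x y : ℕ⁺) → Dec (x ≡ y)
x ≟⁺ y = map′ value-injective (cong value) (value x ≟ value y)

⊆-length : ∀ {A : Set} {xs ys : List A} → Unique xs → (∀ {x} → x ∈ xs → x ∈ ys) → length xs ≤ length ys
⊆-length [] _ = z≤n
⊆-length {xs = x ∷ xs} (x∉xs ∷ unique-xs) xs⊆ys with ∈-∃++ (xs⊆ys (here refl))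
... | as , bs , refl = subst (suc (length xs) ≤_) (sym length-ys) (s≤s (⊆-length unique-xs xs⊆as++bs))
  where
  length-ys : length (as ++ x ∷ bs) ≡ suc (length (as ++ bs))
  length-ys = trans (length-++ as) (trans (+-suc (length as) (length bs)) (cong suc (sym (length-++ as))))
  xs⊆as++bs : ∀ {y} → y ∈ xs → y ∈ as ++ bs
  xs⊆as++bs y∈xs with ∈-++⁻ as (xs⊆ys (there y∈xs))
  ... | inj₁ y∈as         = ∈-++⁺ˡ y∈as
  ... | inj₂ (here refl)  = contradiction refl (All.lookup x∉xs y∈xs)
  ... | inj₂ (there y∈bs) = ∈-++⁺ʳ as y∈bs

HasSize-resp : ∀ {A : Set} {P Q : Pred A 0ℓ} {n} → (∀ x → P x ⇔ Q x) → P HasSize n → Q HasSize n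
HasSize-resp P⇔Q s = record
  { elements = elements s
  ; unique   = unique s
  ; complete = λ x → mk⇔ (to (complete s x) ∘ from (P⇔Q x)) (to (P⇔Q x) ∘ from (complete s x))
  ; size     = size s
  }

HasSize-insert : ∀ {A : Set} {P : Pred A 0ℓ} {n w} → ¬ P w → P HasSize n → (λ x → x ≡ w ⊎ P x) HasSize suc n
HasSize-insert {w = w} ¬Pw s = record
  { elements = w ∷ elements s
  ; unique   = All.tabulate (λ { x∈ refl → ¬Pw (from (complete s _) x∈) }) ∷ unique s
  ; complete = λ x → mk⇔
      (λ { (inj₁ x≡w) → here x≡w ; (inj₂ Px) → there (to (complete s x) Px) })
      (λ { (here x≡w) → inj₁ x≡w ; (there x∈) → inj₂ (from (complete s x) x∈) })
  ; size     = cong suc (size s)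
  }

HasSize-delete : ∀ {P : Pred ℕ⁺ 0ℓ} {n w} → P w → P HasSize suc n → (λ x → P x × x ≢ w) HasSize n
HasSize-delete {w = w} Pw s = record
  { elements = rest
  ; unique   = filter⁺ ≢w? (unique s)
  ; complete = λ x → mk⇔
      (λ (Px , x≢w) → ∈-filter⁺ ≢w? (to (complete s x) Px) x≢w)
      (λ x∈ → let x∈s , x≢w = ∈-filter⁻ ≢w? x∈ in from (complete s x) x∈s , x≢w)
  -- Duplicate-free lists with the same members have the same length.
  ; size     = suc-injective (trans (≤-antisym (⊆-length w∷rest-unique ⊆s) (⊆-length (unique s) s⊆)) (size s))
  }
  where
  ≢w? = λ x → ¬? (x ≟⁺ w)
  rest = filter ≢w? (elements s)
  w∷rest-unique : Unique (w ∷ rest)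
  w∷rest-unique = All.tabulate (λ x∈ w≡x → proj₂ (∈-filter⁻ ≢w? {xs = elements s} x∈) (sym w≡x)) ∷ filter⁺ ≢w? (unique s)
  ⊆s : ∀ {x} → x ∈ w ∷ rest → x ∈ elements s
  ⊆s (here refl) = to (complete s w) Pw
  ⊆s (there x∈)  = proj₁ (∈-filter⁻ ≢w? x∈)
  s⊆ : ∀ {x} → x ∈ elements s → x ∈ w ∷ rest
  s⊆ {x} x∈ with x ≟⁺ w
  ... | yes x≡w = here x≡w
  ... | no  x≢w = there (∈-filter⁺ ≢w? x∈ x≢w)

listBelow : ℕ → (ℕ → Bool) → List ℕ⁺
listBelow zero    p = []
listBelow (suc n) p = if p n then suc⁺ n ∷ listBelow n p else listBelow n p

∈-listBelow⁻ : ∀ n p {x} → x ∈ listBelow n p → pred⁺ x < n × T (p (pred⁺ x))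
∈-listBelow⁻ (suc n) p x∈ with p n in eq
... | false = let x<n , px = ∈-listBelow⁻ n p x∈ in m≤n⇒m≤1+n x<n , px
∈-listBelow⁻ (suc n) p (here refl) | true = ≤-refl , subst T (sym eq) tt
∈-listBelow⁻ (suc n) p (there x∈)  | true = let x<n , px = ∈-listBelow⁻ n p x∈ in m≤n⇒m≤1+n x<n , px

suc⁺-∈-listBelow : ∀ {n i} p → i < n → T (p i) → suc⁺ i ∈ listBelow n p
suc⁺-∈-listBelow {suc n} p i<1+n pi with ≤-suc-split i<1+n
suc⁺-∈-listBelow {suc n} p i<1+n pi | inj₂ refl with p n
... | true = here refl
suc⁺-∈-listBelow {suc n} p i<1+n pi | inj₁ i<n with p n
... | true  = there (suc⁺-∈-listBelow p i<n pi)
... | false = suc⁺-∈-listBelow p i<n pi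

∈-listBelow⁺ : ∀ {n} p {x} → pred⁺ x < n → T (p (pred⁺ x)) → x ∈ listBelow n p
∈-listBelow⁺ {n} p {x} x<n px = subst (_∈ listBelow n p) (suc⁺-pred⁺ x) (suc⁺-∈-listBelow p x<n px)

listBelow-unique : ∀ n p → Unique (listBelow n p)
listBelow-unique zero    p = []
listBelow-unique (suc n) p with p n
... | false = listBelow-unique n p
... | true  = All.tabulate (λ { x∈ refl → <-irrefl refl (proj₁ (∈-listBelow⁻ n p x∈)) }) ∷ listBelow-unique n p

length-listBelow : ∀ n p → length (listBelow n p) ≡ count n p
length-listBelow zero    p = refl
length-listBelow (suc n) p with p n
... | true  = trans (cong suc (length-listBelow n p)) (+-comm 1 (count n p))
... | false = trans (length-listBelow n p) (sym (+-identityʳ (count n p)))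

T-does : ∀ {A : Set} (a? : Dec A) → T (does a?) → A
T-does (yes a) _ = a

does-T : ∀ {A : Set} (a? : Dec A) → A → T (does a?)
does-T (yes _) _ = tt
does-T (no ¬a) a = ¬a a

≤-minus⇒+-≤ : ∀ {n p m} → ℤ.+ n ℤ.≤ (ℤ.+ p) ℤ.- (ℤ.+ m) → m + n ≤ p
≤-minus⇒+-≤ {n} {p} {m} n≤p-m = ℤ.drop‿+≤+ (begin
  ℤ.+ (m + n)                 ≡⟨ cong ℤ.+_ (+-comm m n) ⟩
  (ℤ.+ n) ℤ.+ m⁺              ≤⟨ ℤ.+-monoˡ-≤ m⁺ n≤p-m ⟩
  (p⁺ ℤ.- m⁺) ℤ.+ m⁺          ≡⟨ ℤ.+-assoc p⁺ (ℤ.- m⁺) m⁺ ⟩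
  p⁺ ℤ.+ ((ℤ.- m⁺) ℤ.+ m⁺)    ≡⟨ cong (λ i → p⁺ ℤ.+ i) (ℤ.+-inverseˡ m⁺) ⟩
  p⁺ ℤ.+ ℤ.0ℤ                 ≡⟨ ℤ.+-identityʳ p⁺ ⟩
  p⁺                          ∎)
  where
  open ℤ.≤-Reasoning
  p⁺ m⁺ : ℤ.ℤ
  p⁺ = ℤ.+ p
  m⁺ = ℤ.+ m

maximum : (xs : List ℕ⁺) → ∃[ b ] (∀ {x} → x ∈ xs → pred⁺ x < b)
maximum []       = 0 , λ ()
maximum (x ∷ xs) = let b , bound = maximum xs in suc (pred⁺ x) + b ,
  λ { (here refl) → m≤m+n (suc (pred⁺ x)) b ; (there y∈) → <-≤-trans (bound y∈) (m≤n+m b (suc (pred⁺ x))) }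

-- Computable bounds on neighbourhoods

module Graph (G : Rel ℕ⁺ 0ℓ) (H : HighlyComputable G) where

  open HighlyComputable H

  e : ℕ → ℕ → Bool
  e x y = does (proj₁ computableEdges (suc⁺ x) (suc⁺ y))

  e⇒G : ∀ {x y} → T (e x y) → G (suc⁺ x) (suc⁺ y)
  e⇒G {x} {y} = T-does (proj₁ computableEdges (suc⁺ x) (suc⁺ y))

  G⇒e : ∀ {x y} → G (suc⁺ x) (suc⁺ y) → T (e x y)
  G⇒e {x} {y} = does-T (proj₁ computableEdges (suc⁺ x) (suc⁺ y))

  e⇒G⁺ : ∀ u v → T (e (pred⁺ u) (pred⁺ v)) → G u v
  e⇒G⁺ u v t = subst₂ G (suc⁺-pred⁺ u) (suc⁺-pred⁺ v) (e⇒G t)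

  G⇒e⁺ : ∀ u v → G u v → T (e (pred⁺ u) (pred⁺ v))
  G⇒e⁺ u v g = G⇒e (subst₂ G (sym (suc⁺-pred⁺ u)) (sym (suc⁺-pred⁺ v)) g)

  eᴿ : Decᴿ {2} (λ xs → e (lookup xs zero) (lookup xs (suc zero)))
  eᴿ = let g , gᴿ , eq = proj₂ computableEdges in
    extᴿ (λ xs → eq (suc⁺ (lookup xs zero)) (suc⁺ (lookup xs (suc zero)))) (comp₂ gᴿ (sucᴿ′ x₀) (sucᴿ′ x₁))

  deg : ℕ → ℕ
  deg x = degᵁ (suc⁺ x)

  degᴿ : Recursive {1} (λ xs → deg (lookup xs zero))
  degᴿ = let g , gᴿ , eq = degᵁ-computable in extᴿ (λ xs → eq (suc⁺ (lookup xs zero))) (comp₁ gᴿ (sucᴿ′ x₀))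

  count-≤-deg : ∀ x y → count y (e x) ≤ deg x
  count-≤-deg x y = begin
    count y (e x)              ≡⟨ sym (length-listBelow y (e x)) ⟩
    length (listBelow y (e x)) ≤⟨ ⊆-length (listBelow-unique y (e x)) ⊆N ⟩
    length (elements N-x)      ≡⟨ size N-x ⟩
    deg x                      ∎
    where
    open ≤-Reasoning
    N-x = degᵁ-size (suc⁺ x)
    ⊆N : ∀ {v} → v ∈ listBelow y (e x) → v ∈ elements N-x
    ⊆N {v} v∈ = to (complete N-x v) (e⇒G⁺ (suc⁺ x) v (proj₂ (∈-listBelow⁻ y (e x) v∈)))

  complete-below : ∀ x → ∃[ y ] deg x ≤ count y (e x)
  complete-below x = y , (begin
    deg x                      ≡⟨ sym (size N-x) ⟩
    length (elements N-x)      ≤⟨ ⊆-length (unique N-x) N⊆ ⟩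
    length (listBelow y (e x)) ≡⟨ length-listBelow y (e x) ⟩
    count y (e x)              ∎)
    where
    open ≤-Reasoning
    N-x = degᵁ-size (suc⁺ x)
    y = proj₁ (maximum (elements N-x))
    N⊆ : ∀ {v} → v ∈ elements N-x → v ∈ listBelow y (e x)
    N⊆ {v} v∈ = ∈-listBelow⁺ (e x) (proj₂ (maximum (elements N-x)) v∈) (G⇒e⁺ (suc⁺ x) v (from (complete N-x v) v∈))

  missing : ℕ → ℕ → ℕ
  missing x y = deg x ∸ count y (e x)

  opaque

    -- The search bound is read off the lists of neighbours, which are not given by a recursive
    -- function; it serves only to show that a zero exists. By `nb-least` the value is the unbounded
    -- minimum, so `minᴿ` applies.
    nb : ℕ → ℕ
    nb x = least (suc (proj₁ (complete-below x))) (λ y → missing x y ≡ᵇ 0)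

    nb-least : ∀ x → IsLeastZero (missing x) (nb x)
    nb-least x = ≡ᵇ⇒≡ (missing x (nb x)) 0
        (least-witness (λ y → missing x y ≡ᵇ 0) (n<1+n y₀) (≡⇒≡ᵇ (missing x y₀) 0 (m≤n⇒m∸n≡0 (proj₂ (complete-below x))))) ,
      λ z z< m≡0 → least-minimal (suc y₀) (λ y → missing x y ≡ᵇ 0) z< (≡⇒≡ᵇ (missing x z) 0 m≡0)
      where
      y₀ : ℕ
      y₀ = proj₁ (complete-below x)

  -- Below `nb x` already `deg x` neighbours are counted, and one more would exceed the degree.
  nb-bound : ∀ {x y} → T (e x y) → y < nb x
  nb-bound {x} {y} exy with <-≤-connex y (nb x)
  ... | inj₁ y<nb = y<nb
  ... | inj₂ nb≤y = ⊥-elim (<-irrefl refl (begin-strict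
    deg x                  ≤⟨ m∸n≡0⇒m≤n (proj₁ (nb-least x)) ⟩
    count (nb x) (e x)     ≤⟨ ∑-≤-bound (λ w → ⟦ e x w ⟧) nb≤y ⟩
    count y (e x)          <⟨ n<1+n _ ⟩
    suc (count y (e x))    ≡⟨ +-comm 1 (count y (e x)) ⟩
    count y (e x) + 1      ≡⟨ cong (count y (e x) +_) (sym (⟦T⟧ exy)) ⟩
    count (suc y) (e x)    ≤⟨ count-≤-deg x (suc y) ⟩
    deg x                  ∎))
    where open ≤-Reasoning

  nbᴿ : Recursive {1} (λ xs → nb (lookup xs zero))
  nbᴿ = minᴿ {f = λ ys → missing (lookup ys (suc zero)) (lookup ys zero)}
    (∸ᴿ (comp₁ degᴿ x₁) (∑ᴿ (comp₂ eᴿ x₂ x₀) x₀)) (λ xs → nb-least (lookup xs zero))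

-- parent x is 0 when x has no parent, and kid u i is only relevant for i < d.
record ComputableForest (d : ℕ) (G : Rel ℕ⁺ 0ℓ) : Set where
  field
    parent        : ℕ → ℕ
    kid           : ℕ → ℕ → ℕ
    parent-zero   : parent 0 ≡ 0
    parent-kid    : ∀ {u i} → 1 ≤ u → i < d → parent (kid u i) ≡ u
    parent-elim   : ∀ {x u} → 1 ≤ u → parent x ≡ u → ∃[ i ] i < d × kid u i ≡ x
    kid-injective : ∀ u {i j} → kid u i ≡ kid u j → i ≡ j
    kid-positive  : ∀ u i → 1 ≤ kid u i
    parent-edge   : ∀ u v → parent (value v) ≡ value u → G u v
    parentᴿ       : Recursive {1} (λ xs → parent (lookup xs zero))
    kidᴿ          : ∀ i → Recursive {1} (λ xs → kid (lookup xs zero) i)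

-- The forest of children in the given graph

module Construction
  (d : ℕ) .{{_ : NonZero d}} (1≤d : 1 ≤ d) (G : Rel ℕ⁺ 0ℓ) (H : HighlyComputable G)
  (G-sym : FullyReflected G) (C : CEHallHarem d G)
  where

  open CEHallHarem C
  open Graph G H

  e-sym : ∀ {x y} → T (e x y) → T (e y x)
  e-sym t = G⇒e (G-sym (e⇒G t))

  open Greedy d 1≤d e e-sym nb nb-bound
  open Neighbours e

  expand : ∀ L X n → h n ≤ count L X → d * count L X + n ≤ count (β L) (nbr L X)
  expand L X n h≤ =
    subst (λ l → d * l + n ≤ count (β L) (nbr L X)) (length-listBelow L X)
      (≤-minus⇒+-≤ (expandᵁ (listBelow L X) (listBelow-unique L X) _ neighbourhood n
        (subst (h n ≤_) (sym (length-listBelow L X)) h≤)))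
    where
    neighbourhood : N[ G ] (listBelow L X) HasSize count (β L) (nbr L X)
    neighbourhood = record
      { elements = listBelow (β L) (nbr L X)
      ; unique   = listBelow-unique (β L) (nbr L X)
      ; complete = λ y → mk⇔
          (λ (x , x∈ , Gxy) →
            let x<L , Xx = ∈-listBelow⁻ L X x∈ ; exy = G⇒e⁺ x y Gxy
            in ∈-listBelow⁺ (nbr L X) (β-bound x<L exy) (nbr-intro X x<L Xx exy))
          (λ y∈ →
            let _ , n = ∈-listBelow⁻ (β L) (nbr L X) y∈
                x , x<L , Xx , exy = nbr-elim L X n
            in suc⁺ x , suc⁺-∈-listBelow X x<L Xx , e⇒G⁺ (suc⁺ x) y exy)
      ; size     = length-listBelow (β L) (nbr L X)
      }

  open Slots h h-zero expand

  owner-block : ∀ u {i} → i < d → owner (d * u + i) ≡ u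
  owner-block u {i} i<d = owner-unique (m≤m+n (d * u) i)
    (<-≤-trans (+-monoʳ-< (d * u) i<d) (≤-reflexive (trans (+-comm (d * u) d) (sym (*-suc d u)))))

  slot-block-edge : ∀ u {i} → i < d → T (e u (slot (d * u + i)))
  slot-block-edge u {i} i<d = subst (λ x → T (e x (slot (d * u + i)))) (owner-block u i<d) (slot-edge (d * u + i))

  slot-bound : ∀ u i → i < d → u < β (suc (slot (d * u + i)))
  slot-bound u i i<d = β-bound {x = slot (d * u + i)} (n<1+n _) (e-sym {u} (slot-block-edge u i<d))

  open Parents d slot slot-injective β slot-bound

  parent-edge : ∀ u v → parent (value v) ≡ value u → G u v
  parent-edge u v eq =
    let i , i<d , kid≡v = parent-elim {value v} (value-positive u) eq
    in e⇒G⁺ u v (subst (T ∘ e (pred⁺ u)) (suc-injective (trans kid≡v (sym (suc-pred⁺ v)))) (slot-block-edge (pred⁺ u) i<d))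

  private
    hᴿ : Recursive {1} (λ xs → h (lookup xs zero))
    hᴿ = comp₁ h-computable x₀

    greedyᴿ : Recursive {1} (λ xs → slot (lookup xs zero))
    greedyᴿ = slotᴿ eᴿ nbᴿ hᴿ x₀

  forest : ComputableForest d G
  forest = record
    { parent        = parent
    ; kid           = kid
    ; parent-zero   = parent-zero
    ; parent-kid    = λ {u} {i} → parent-kid {u} {i}
    ; parent-elim   = parent-elim
    ; kid-injective = kid-injective
    ; kid-positive  = λ u i → s≤s z≤n
    ; parent-edge   = parent-edge
    ; parentᴿ       = parentᴿ greedyᴿ (βᴿ eᴿ nbᴿ hᴿ x₀)
    ; kidᴿ          = λ i → kidᴿ greedyᴿ x₀ (constᴿ i)
    }

-- The matching and its cycles

module Matching
  (d : ℕ) (2≤d : 2 ≤ d) (G : Rel ℕ⁺ 0ℓ) (G-sym : FullyReflected G) (forest : ComputableForest d G)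
  where

  open ComputableForest forest

  1≤d : 1 ≤ d
  1≤d = <⇒≤ 2≤d

  open Pairing parent parent-zero (λ u → kid u 0) (λ u → kid u 1)
    (λ {u} 1≤u → parent-kid {u} {0} 1≤u 1≤d) (λ {u} 1≤u → parent-kid {u} {1} 1≤u 2≤d)
    (λ {u} _ eq → contradiction (kid-injective u {0} {1} eq) λ ())

  children : ∀ u → (λ v → parent (value v) ≡ value u) HasSize d
  children u = record
    { elements = mapᴸ child (upTo d)
    ; unique   = map⁺ (kid-injective (value u) ∘ cong value) (upTo⁺ d)
    ; complete = λ v → mk⇔
        (λ eq → let i , i<d , kid≡v = parent-elim (value-positive u) eq
                in subst (_∈ mapᴸ child (upTo d)) (value-injective kid≡v) (∈-map⁺ child (∈-upTo⁺ i<d)))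
        (λ v∈ → let i , i∈ , v≡ = ∈-map⁻ child v∈
                in trans (cong (parent ∘ value) v≡) (parent-kid (value-positive u) (∈-upTo⁻ i∈)))
    ; size     = trans (length-map child (upTo d)) (length-upTo d)
    }
    where
    child : ℕ → ℕ⁺
    child i = fromPositive (kid (value u) i) (kid-positive (value u) i)

  f⁺ : ℕ⁺ → ℕ⁺
  f⁺ x = fromPositive (f (value x)) (f-positive (value-positive x))

  f⁺-edge : ∀ v → G (f⁺ v) v
  f⁺-edge v with f-edge (value-positive v)
  ... | inj₁ P≡ = G-sym (parent-edge v (f⁺ v) P≡)
  ... | inj₂ P≡ = parent-edge (f⁺ v) v P≡

  -- Dropping a child leaves `d - 1`. For a paired vertex the heir is then replaced by the parent,
  -- so the number stays the same; writing `d` as `suc (suc (d ∸ 2))` allows both deletions.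
  preimages : ((d ∸ 1) to-1) f⁺
  preimages u = subst (λ n → (λ x → f⁺ x ≡ u) HasSize (n ∸ 1)) d≡ (sized (Paired? (value u)))
    where
    d≡ : suc (suc (d ∸ 2)) ≡ d
    d≡ = m+[n∸m]≡n 2≤d
    1≤u = value-positive u
    dropped heir⁺ : ℕ⁺
    dropped = fromPositive (drop (value u)) (P≥1 1≤u (P-drop 1≤u))
    heir⁺ = fromPositive (heir (value u)) (P≥1 1≤u (proj₁ (heir-spec 1≤u)))
    kept : (λ v → parent (value v) ≡ value u × v ≢ dropped) HasSize suc (d ∸ 2)
    kept = HasSize-delete (P-drop 1≤u) (subst (_ HasSize_) (sym d≡) (children u))
    sized : Paired (value u) ⊎ ¬ Paired (value u) → (λ x → f⁺ x ≡ u) HasSize suc (d ∸ 2)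
    sized (inj₂ ¬p) = HasSize-resp (λ x → mk⇔
      (λ (P≡ , ≢drop) → value-injective (unpaired-image 1≤u ¬p P≡ (≢drop ∘ value-injective)))
      (λ f≡ → let P≡ , ≢drop = unpaired-preimage (value-positive x) 1≤u ¬p (cong value f≡)
              in P≡ , ≢drop ∘ cong value)) kept
    sized (inj₁ p) = HasSize-resp (λ x → mk⇔
      (λ { (inj₁ refl) → value-injective (paired-image-P p)
         ; (inj₂ ((P≡ , ≢drop) , ≢heir)) →
             value-injective (paired-image 1≤u P≡ (≢drop ∘ value-injective) (≢heir ∘ value-injective)) })
      (λ f≡ → case (paired-preimage (value-positive x) 1≤u p (cong value f≡))))
      (HasSize-insert {w = grandparent} excluded
        (HasSize-delete {w = heir⁺} (proj₁ (heir-spec 1≤u) , proj₂ (heir-spec 1≤u) ∘ sym ∘ cong value) kept))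
      where
      grandparent : ℕ⁺
      grandparent = fromPositive (parent (value u)) (linked⇒1≤P (proj₁ p))
      excluded : ¬ ((parent (value grandparent) ≡ value u × grandparent ≢ dropped) × grandparent ≢ heir⁺)
      excluded ((P≡ , ≢drop) , ≢heir) =
        ≢heir (value-injective (paired-P-excluded 1≤u p P≡ (≢drop ∘ value-injective)))
      case : ∀ {x} → value x ≡ parent (value u) ⊎
                     (parent (value x) ≡ value u × value x ≢ drop (value u) × value x ≢ heir (value u)) →
             x ≡ grandparent ⊎ ((parent (value x) ≡ value u × x ≢ dropped) × x ≢ heir⁺)
      case (inj₁ eq) = inj₁ (value-injective eq)
      case (inj₂ (P≡ , ≢drop , ≢heir)) = inj₂ ((P≡ , ≢drop ∘ cong value) , ≢heir ∘ cong value)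

  M : Rel ℕ⁺ 0ℓ
  M u v = f⁺ v ≡ u

  perfect : PerfectMatching (d ∸ 1) G M
  perfect = record
    { edges   = λ { {u} {v} refl → f⁺-edge v }
    ; uniqueᵁ = λ v → f⁺ v , refl , λ eq → eq
    ; k-manyⱽ = preimages
    }

  f-recursive : ∀ {n} {g : Vec ℕ n → ℕ} → Recursive g → Recursive (λ xs → f (g xs))
  f-recursive = fᴿ parentᴿ (kidᴿ 0) (kidᴿ 1)

  f⁺-computable : Computable⁺ (value ∘ f⁺)
  f⁺-computable = (λ xs → f (lookup xs zero)) , f-recursive x₀ , λ x → refl

  M-computable : ComputableSet M
  M-computable = (λ u v → f⁺ v ≟⁺ u) ,
    -- The decision by `_≟⁺_` computes to `_≡ᵇ_` on the underlying numbers.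
    (λ xs → ⟦ f (lookup xs (suc zero)) ≡ᵇ lookup xs zero ⟧) , ≡ᵇᴿ (f-recursive x₁) x₀ , λ x y → refl

  open Endo ℕ⁺ using () renaming (_^_ to _^ᴱ_)

  value-^ : ∀ i x → value ((f⁺ ^ᴱ i) x) ≡ iter f (value x) i
  value-^ zero    x = refl
  value-^ (suc i) x = cong f (value-^ i x)

  cycle-length-≤ : ∀ {x k l i} → 1 ≤ i → iter f x i ≡ x → iter f x (k + l) ≡ iter f x k → iter f x l ≡ x
  cycle-length-≤ {x} {k} {l} {i} 1≤i cycle eq = begin
    iter f x l                         ≡⟨ cong (λ z → iter f z l) (sym returns) ⟩
    iter f (iter f x (k + r)) l        ≡⟨ sym (iter-+ f x (k + r) l) ⟩
    iter f x (k + r + l)               ≡⟨ cong (iter f x) (trans (+-assoc k r l) (trans (cong (k +_) (+-comm r l)) (sym (+-assoc k l r)))) ⟩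
    iter f x (k + l + r)               ≡⟨ iter-+ f x (k + l) r ⟩
    iter f (iter f x (k + l)) r        ≡⟨ cong (λ z → iter f z r) eq ⟩
    iter f (iter f x k) r              ≡⟨ sym (iter-+ f x k r) ⟩
    iter f x (k + r)                   ≡⟨ returns ⟩
    x                                  ∎
    where
    open ≡-Reasoning
    -- This makes `k + r` the multiple `k * i` of the cycle length, so continuing the repetition by
    -- `r` steps brings it back to `x`.
    r = k * i ∸ k
    multiple : ∀ m → iter f x (m * i) ≡ x
    multiple zero    = refl
    multiple (suc m) = trans (iter-+ f x i (m * i)) (trans (cong (λ z → iter f z (m * i)) cycle) (multiple m))
    returns : iter f x (k + r) ≡ x
    returns = trans (cong (iter f x) (m+[n∸m]≡n (subst (_≤ k * i) (*-identityʳ k) (*-monoʳ-≤ k 1≤i)))) (multiple k)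

  -- Eventual periodicity serves both clauses: for a periodic point, `l` is itself a return time,
  -- and minimality of the cycle length `i` gives `i ≤ l`.
  controlled : ControlledCycles f⁺
  controlled = record
    { one         = value-injective f-involutive-1
    ; periodic    = λ x 2≤x i (1≤i , cycle , minimal) →
        let k , l , _ , 1≤l , l≤x , eq = eventually-periodic (value x) 2≤x
            l-cycle = cycle-length-≤ {k = k} 1≤i (trans (sym (value-^ i x)) (cong value cycle)) eq
        in ≤-trans (≮⇒≥ (λ l<i → minimal l 1≤l l<i (value-injective (trans (value-^ l x) l-cycle)))) l≤x
    ; nonperiodic = λ x 2≤x _ →
        let k , l , k≤2x , 1≤l , l≤x , eq = eventually-periodic (value x) 2≤x
        in k , l , k≤2x , 1≤l , l≤x , value-injective (trans (value-^ (k + l) x) (trans eq (sym (value-^ k x))))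
    }

theorem4p1 : (d : ℕ) .{{_ : NonZero d}} → 2 ≤ d →
    (E : Rel ℕ⁺ 0ℓ) →
    HighlyComputable E →
    NoEdgeToCopy E →
    FullyReflected E →
    CEHallHarem d E →
    Σ[ M ∈ Rel ℕ⁺ 0ℓ ]
    PerfectMatching (d ∸ 1) E M × ComputableSet M ×
    (Σ[ f ∈ (ℕ⁺ → ℕ⁺) ]
    Realizes M f × Computable⁺ (value ∘ f) ×
    ((d ∸ 1) to-1) f × ControlledCycles f)
theorem4p1 d 2≤d E H _ E-sym C =
  M , perfect , M-computable , f⁺ , (λ u v → mk⇔ (λ eq → eq) (λ eq → eq)) ,
  f⁺-computable , preimages , controlled
  where open Matching d 2≤d E E-sym (Construction.forest d (<⇒≤ 2≤d) E H E-sym C)
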